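{- There is a 3-connected non-complete planar graph which is not degree-truncated $7$-choosable.
   Context: Graphs are finite and simple. A list assignment of a graph $G$ is a mapping $L$ assigning to each vertex $v$ a set $L(v)$ of permissible colours. An $L$-colouring of $G$ is a mapping $\phi$ with $\phi(v)\in L(v)$ for every vertex $v$ and $\phi(u)\neq\phi(v)$ for every edge $uv$; $G$ is $L$-colourable if it has an $L$-colouring. For a positive integer $k$, $G$ is degree-truncated $k$-choosable if $G$ is $L$-colourable for every list assignment $L$ with $|L(v)|\ge \min\{k,d_G(v)\}$ for every vertex $v$, where $d_G(v)$ is the degree of $v$ in $G$. -}

module Defs where

open import Data.List.Base using (List; []; _∷_; _++_; length; filter; reverse)
open import Data.List.Membership.Propositional using (_∈_; _∉_)
open import Data.List.Relation.Unary.Unique.Propositional using (Unique)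
open import Data.Nat.Base using (ℕ; _⊓_) renaming (_≤_ to _≤ℕ_; _<_ to _<ℕ_)
open import Data.Product.Base using (Σ-syntax; ∃-syntax; _×_; _,_; proj₁; proj₂)
open import Data.Rational.Base using (ℚ; 0ℚ; 1ℚ; _+_; _-_; _*_; _≤_)
open import Data.Sum.Base using (_⊎_)
open import Function.Definitions using (Injective)
open import Relation.Binary.Construct.Closure.ReflexiveTransitive using (Star)
open import Relation.Binary.Core using (Rel)
open import Relation.Binary.Definitions using (Decidable; Irreflexive; Symmetric)
open import Relation.Binary.PropositionalEquality.Core using (_≡_; _≢_)
open import Relation.Nullary.Negation.Core using (¬_)
open import Level using (0ℓ)

record Graph : Set₁ where
  infix 4 _~_ _~?_
  field
    Vertex   : Set
    vertices : List Vertex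
    complete : ∀ v → v ∈ vertices
    unique   : Unique vertices

    _~_      : Rel Vertex 0ℓ
    _~?_     : Decidable _~_
    ~-sym    : Symmetric _~_
    ~-irrefl : Irreflexive _≡_ _~_

  order : ℕ
  order = length vertices

  degree : Vertex → ℕ
  degree v = length (filter (v ~?_) vertices)

IsComplete : Graph → Set
IsComplete G = ∀ u v → u ≢ v → u ~ v
  where open Graph G

module _ (G : Graph) where
  open Graph G

  -- The graph G − X is connected.
  ConnectedWithout : List Vertex → Set
  ConnectedWithout X =
    ∀ u v → u ∉ X → v ∉ X → Star (λ x y → x ∉ X × y ∉ X × x ~ y) u v

-- The list X stands for its set of elements; repetitions are harmless, since
-- the lists of length < k have exactly the sets of size < k as underlying sets.
IsConnected : ℕ → Graph → Set
IsConnected k G =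
  k <ℕ order × (∀ (X : List Vertex) → length X <ℕ k → ConnectedWithout G X)
  where open Graph G

------------------------------------------------------------------------
-- Plane drawings whose edges are polygonal arcs.  Coordinates are rational:
-- segments with rational ends that meet over ℝ already meet in a rational
-- point, so such a drawing is a drawing in ℝ², and every planar graph has one.

Point : Set
Point = ℚ × ℚ

_∈[_,_] : Point → Point → Point → Set
p ∈[ a , b ] =
  ∃[ t ] 0ℚ ≤ t × t ≤ 1ℚ ×
    p ≡ ( proj₁ a + t * (proj₁ b - proj₁ a)
        , proj₂ a + t * (proj₂ b - proj₂ a))

data _on_ (p : Point) : List Point → Set where
  here  : ∀ {a b ps} → p ∈[ a , b ]   → p on (a ∷ b ∷ ps)
  there : ∀ {a b ps} → p on (b ∷ ps) → p on (a ∷ b ∷ ps)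

-- The polygonal curve through the given points does not meet itself.
data IsArc : List Point → Set where
  segment : ∀ {a b} → a ≢ b → IsArc (a ∷ b ∷ [])
  extend  : ∀ {a b c ps} → a ≢ b →
            (∀ p → p ∈[ a , b ] → p on (b ∷ c ∷ ps) → p ≡ b) →
            IsArc (b ∷ c ∷ ps) → IsArc (a ∷ b ∷ c ∷ ps)

record PlaneDrawing (G : Graph) : Set where
  open Graph G
  field
    position : Vertex → Point
    -- Inner corner points of the arc from u to v; irrelevant unless u ~ v.
    bends    : Vertex → Vertex → List Point

  arc : Vertex → Vertex → List Point
  arc u v = position u ∷ bends u v ++ position v ∷ []

  field
    position-injective : Injective _≡_ _≡_ position
    bends-sym  : ∀ {u v} → u ~ v → bends v u ≡ reverse (bends u v)
    arc-simple : ∀ {u v} → u ~ v → IsArc (arc u v)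
    -- The interior of an edge contains no vertex ...
    no-vertex  : ∀ {u v w} → u ~ v → position w on arc u v → w ≡ u ⊎ w ≡ v
    -- ... and no point of any other edge.
    no-crossing : ∀ {u v x y} → u ~ v → x ~ y →
                  ¬ ((u ≡ x × v ≡ y) ⊎ (u ≡ y × v ≡ x)) →
                  ∀ p → p on arc u v → p on arc x y →
                  p ≡ position u ⊎ p ≡ position v

IsPlanar : Graph → Set
IsPlanar = PlaneDrawing

------------------------------------------------------------------------

record ListAssignment (G : Graph) (Colour : Set) : Set where
  open Graph G
  field
    colours : Vertex → List Colour
    unique  : ∀ v → Unique (colours v)

  size : Vertex → ℕ
  size v = length (colours v)

module _ (G : Graph) {Colour : Set} (L : ListAssignment G Colour) where
  open Graph G
  open ListAssignment L using (colours)

  IsColourable : Set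
  IsColourable =
    Σ[ φ ∈ (Vertex → Colour) ]
      (∀ v → φ v ∈ colours v) × (∀ u v → u ~ v → φ u ≢ φ v)

IsDegreeTruncatedChoosable : ℕ → Graph → Set₁
IsDegreeTruncatedChoosable k G =
  ∀ {Colour : Set} (L : ListAssignment G Colour) →
  (∀ v → k ⊓ Graph.degree G v ≤ℕ ListAssignment.size L v) →
  IsColourable G L

{-# OPTIONS --safe #-}
-- Two poles see a row of sites, and for every pole σ and every pair of
-- consecutive sites z, z′ there is a unit: a hub joined to σ, z, z′ and, for
-- each d ∈ {z, z′}, a vertex near d joined to σ, d, hub and a vertex far d
-- joined to d, hub, near d.  If σ has colour t and A, B are disjoint triples of
-- colours, then the lists {t} ∪ A ∪ B for the hub, {t} ∪ A and A on the z side
-- and {t} ∪ B and B on the z′ side forbid z ∈ A, z′ ∈ B: a hub colour in A, say,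
-- would leave K₄ on z, hub, near, far to be coloured from three colours.
-- Each of the 49 colourings of the poles is blocked by three consecutive sites
-- with lists T₀ ∪ T₁, D₀ ∪ D₁, T₀ ∪ T₁ (plus one pole colour): the units forbid
-- Tₕ × D₀ between the first two sites and D₁ × Tₕ between the last two, where h
-- is the pole of the unit.
-- The graph is drawn with straight edges: the sites lie on the x-axis, the poles
-- above and below it, and the units are sheared copies of one stacked triangle.
module Submission where

open import Data.Bool.Base using (Bool; true; false; not)
import Data.Bool.Properties as Bool
open import Data.Empty using (⊥)
open import Data.Fin.Base as Fin using (Fin; zero; suc; toℕ; inject₁; combine; remQuot)
open import Data.Fin.Induction using (<-weakInduction)
import Data.Fin.Properties as Fin
open import Data.Integer.Base as ℤ using (ℤ; +_; -[1+_]; 0ℤ)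
import Data.Integer.Properties as ℤ
open import Data.Integer.Solver using (module +-*-Solver)
open import Data.List.Base using (List; []; _∷_; _++_; length; deduplicate; allFin; cartesianProductWith)
  renaming (map to mapᴸ; lookup to lookupᴸ)
import Data.List.Membership.DecPropositional as DecMembership
open import Data.List.Membership.Propositional using (_∈_; _∉_)
open import Data.List.Membership.Propositional.Properties
  using (∈-map⁺; ∈-map⁻; ∈-++⁺ˡ; ∈-++⁺ʳ; ∈-allFin; ∈-cartesianProductWith⁺; ∈-cartesianProductWith⁻;
         ∈-deduplicate⁺; ∈-filter⁻; ∈-lookup)
open import Data.List.Relation.Binary.Subset.Propositional using (_⊆_)
open import Data.List.Relation.Unary.All as All using (All; []; _∷_; all?)
open import Data.List.Relation.Unary.All.Properties using (¬All⇒Any¬)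
open import Data.List.Relation.Unary.AllPairs using ([]; _∷_)
open import Data.List.Relation.Unary.Any as Any using (Any; here; there; any?; satisfied)
open import Data.List.Relation.Unary.Any.Properties using (lookup-index)
import Data.List.Relation.Unary.Unique.DecPropositional.Properties as DecUnique
open import Data.List.Relation.Unary.Unique.Propositional using (Unique)
import Data.List.Relation.Unary.Unique.Propositional.Properties as Unique
open import Data.Nat.Base as ℕ using (ℕ; s≤s; z≤n)
import Data.Nat.Properties as ℕ
open import Data.Product.Base using (Σ-syntax; ∃-syntax; _×_; _,_; proj₁; proj₂)
import Data.Product.Base as Product
open import Data.Rational.Base as ℚ using (ℚ; 0ℚ; 1ℚ)
open import Data.Rational.Literals using (fromℤ)
import Data.Rational.Properties as ℚ
import Data.Rational.Solver as ℚSolver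
import Data.Rational.Unnormalised.Base as ℚᵘ
import Data.Rational.Unnormalised.Properties as ℚᵘ
open import Data.Sum.Base using (_⊎_; inj₁; inj₂; [_,_]′; map; map₁; map₂; swap)
open import Function.Base using (_∘_; _$_)
open import Relation.Binary.Construct.Closure.ReflexiveTransitive using (Star; ε; _◅_; _◅◅_; reverse)
open import Relation.Binary.Definitions using (DecidableEquality; tri<; tri≈; tri>)
open import Relation.Binary.PropositionalEquality
open import Relation.Nullary.Decidable
  using (Dec; yes; no; map′; _⊎-dec_; _×-dec_; ¬?; decidable-stable; from-yes)
open import Relation.Nullary.Negation.Core using (¬_; contradiction)
open import Defs

-- Pigeonhole principle for lists without repetitions

lookup-injective : ∀ {A : Set} {xs : List A} → Unique xs →
                   ∀ {i j} → lookupᴸ xs i ≡ lookupᴸ xs j → i ≡ j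
lookup-injective (_ ∷ _) {zero} {zero} _ = refl
lookup-injective {xs = _ ∷ xs} (x≢ ∷ _) {zero} {suc j} eq = contradiction eq (All.lookup x≢ (∈-lookup j))
lookup-injective {xs = _ ∷ xs} (x≢ ∷ _) {suc i} {zero} eq = contradiction (sym eq) (All.lookup x≢ (∈-lookup i))
lookup-injective (_ ∷ u) {suc i} {suc j} eq = cong suc (lookup-injective u eq)

-- Sending a position in `xs` to a position of the same entry in `ys` is injective, because the
-- entry can be read back from the image. Used to bound degrees, to limit what two deleted vertices
-- can hit, and to exclude four distinct colours from a triple.
unique-⊆-length : ∀ {A : Set} {xs ys : List A} → Unique xs → xs ⊆ ys → length xs ℕ.≤ length ys
unique-⊆-length {xs = xs} {ys} u xs⊆ys = Fin.injective⇒≤ {f = f} inj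
  where
  f : Fin (length xs) → Fin (length ys)
  f i = Any.index (xs⊆ys (∈-lookup i))
  inj : ∀ {i j} → f i ≡ f j → i ≡ j
  inj {i} {j} eq = lookup-injective u (begin
    lookupᴸ xs i     ≡⟨ lookup-index (xs⊆ys (∈-lookup i)) ⟩
    lookupᴸ ys (f i) ≡⟨ cong (lookupᴸ ys) eq ⟩
    lookupᴸ ys (f j) ≡⟨ lookup-index (xs⊆ys (∈-lookup j)) ⟨
    lookupᴸ xs j     ∎)
    where open ≡-Reasoning

-- The graph

data Inner : Set where
  hub      : Inner
  near far : (d : Bool) → Inner

data Local : Set where
  apex  : Local
  base  : (d : Bool) → Local
  inner : (i : Inner) → Local

-- Each inner vertex of a unit is stacked into the triangle of these three.
stack : Inner → List Local
stack hub      = apex   ∷ base false ∷ base true      ∷ []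
stack (near d) = apex   ∷ base d     ∷ inner hub      ∷ []
stack (far d)  = base d ∷ inner hub  ∷ inner (near d) ∷ []

inners : List Inner
inners = hub ∷ near false ∷ near true ∷ far false ∷ far true ∷ []

∈-inners : ∀ i → i ∈ inners
∈-inners hub          = here refl
∈-inners (near false) = there (here refl)
∈-inners (near true)  = there (there (here refl))
∈-inners (far false)  = there (there (there (here refl)))
∈-inners (far true)   = there (there (there (there (here refl))))

_≟ⁱ_ : DecidableEquality Inner
hub    ≟ⁱ hub    = yes refl
hub    ≟ⁱ near _ = no λ ()
hub    ≟ⁱ far _  = no λ ()
near _ ≟ⁱ hub    = no λ ()
near d ≟ⁱ near e = map′ (cong near) (λ { refl → refl }) (d Bool.≟ e)
near _ ≟ⁱ far _  = no λ ()
far _  ≟ⁱ hub    = no λ ()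
far _  ≟ⁱ near _ = no λ ()
far d  ≟ⁱ far e  = map′ (cong far) (λ { refl → refl }) (d Bool.≟ e)

_≟ˡ_ : DecidableEquality Local
apex    ≟ˡ apex    = yes refl
apex    ≟ˡ base _  = no λ ()
apex    ≟ˡ inner _ = no λ ()
base _  ≟ˡ apex    = no λ ()
base d  ≟ˡ base e  = map′ (cong base) (λ { refl → refl }) (d Bool.≟ e)
base _  ≟ˡ inner _ = no λ ()
inner _ ≟ˡ apex    = no λ ()
inner _ ≟ˡ base _  = no λ ()
inner i ≟ˡ inner j = map′ (cong inner) (λ { refl → refl }) (i ≟ⁱ j)

bools : List Bool
bools = false ∷ true ∷ []

∈-bools : ∀ b → b ∈ bools
∈-bools false = here refl
∈-bools true  = there (here refl)

module Strip (N : ℕ) where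

  -- The offsets guarantee three sites, which serve as common neighbours of the poles, and make
  -- `inject₁` and `suc` the two ends of a gap.
  Site Gap : Set
  Site = Fin (3 ℕ.+ N)
  Gap  = Fin (2 ℕ.+ N)

  data Vertex : Set where
    pole   : (σ : Bool) → Vertex
    site   : (m : Site) → Vertex
    inside : (σ : Bool) (n : Gap) (i : Inner) → Vertex

  site-injective : ∀ {m n} → site m ≡ site n → m ≡ n
  site-injective refl = refl

  side : Gap → Bool → Site
  side n false = inject₁ n
  side n true  = suc n

  embed : Bool → Gap → Local → Vertex
  embed σ n apex      = pole σ
  embed σ n (base d)  = site (side n d)
  embed σ n (inner i) = inside σ n i

  -- Every edge is recorded once, at its later end in the order poles, sites, hubs, near, far;
  -- adjacency is the symmetric closure.
  parents : Vertex → List Vertex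
  parents (pole _)       = []
  parents (site _)       = mapᴸ pole bools
  parents (inside σ n i) = mapᴸ (embed σ n) (stack i)

  _≟_ : DecidableEquality Vertex
  pole σ       ≟ pole τ       = map′ (cong pole) (λ { refl → refl }) (σ Bool.≟ τ)
  pole _       ≟ site _       = no λ ()
  pole _       ≟ inside _ _ _ = no λ ()
  site _       ≟ pole _       = no λ ()
  site m       ≟ site n       = map′ (cong site) (λ { refl → refl }) (m Fin.≟ n)
  site _       ≟ inside _ _ _ = no λ ()
  inside _ _ _ ≟ pole _       = no λ ()
  inside _ _ _ ≟ site _       = no λ ()
  inside σ m i ≟ inside τ n j with σ Bool.≟ τ | m Fin.≟ n | i ≟ⁱ j
  ... | yes refl | yes refl | yes refl = yes refl
  ... | no σ≢τ   | _        | _        = no λ { refl → σ≢τ refl }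
  ... | yes _    | no m≢n   | _        = no λ { refl → m≢n refl }
  ... | yes _    | yes _    | no i≢j   = no λ { refl → i≢j refl }

  open DecMembership _≟_ using (_∈?_)

  enumeration : List Vertex
  enumeration = mapᴸ pole bools ++ mapᴸ site (allFin _) ++
    cartesianProductWith _$_ (cartesianProductWith inside bools (allFin _)) inners

  ∈-enumeration : ∀ v → v ∈ enumeration
  ∈-enumeration (pole σ)       = ∈-++⁺ˡ (∈-map⁺ pole (∈-bools σ))
  ∈-enumeration (site m)       = ∈-++⁺ʳ (mapᴸ pole bools) (∈-++⁺ˡ (∈-map⁺ site (∈-allFin m)))
  ∈-enumeration (inside σ n i) = ∈-++⁺ʳ (mapᴸ pole bools) (∈-++⁺ʳ (mapᴸ site (allFin _))
    (∈-cartesianProductWith⁺ _$_ (∈-cartesianProductWith⁺ inside (∈-bools σ) (∈-allFin n)) (∈-inners i)))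

  parents-irrefl : ∀ v → v ∉ parents v
  parents-irrefl (site _)              (there (here ()))
  parents-irrefl (site _)              (there (there ()))
  parents-irrefl (inside _ _ hub)      (there (there (there ())))
  parents-irrefl (inside _ _ (near _)) (there (there (here ())))
  parents-irrefl (inside _ _ (near _)) (there (there (there ())))
  parents-irrefl (inside _ _ (far _))  (there (there (here ())))
  parents-irrefl (inside _ _ (far _))  (there (there (there ())))

  G : Graph
  G = record
    { Vertex   = Vertex
    -- Deduplication supplies `Unique`, so only exhaustiveness of `enumeration` has to be proved.
    ; vertices = deduplicate _≟_ enumeration
    ; complete = λ v → ∈-deduplicate⁺ _≟_ (∈-enumeration v)
    ; unique   = DecUnique.deduplicate-! _≟_ enumeration
    ; _~_      = λ u v → u ∈ parents v ⊎ v ∈ parents u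
    ; _~?_     = λ u v → (u ∈? parents v) ⊎-dec (v ∈? parents u)
    ; ~-sym    = swap
    ; ~-irrefl = λ { refl (inj₁ v∈) → parents-irrefl _ v∈ ; refl (inj₂ v∈) → parents-irrefl _ v∈ }
    }

  open Graph G using (_~_; _~?_; ~-sym; vertices; degree; order)

  -- Oriented edges as an inductive family: later case analyses run over two kinds of edge instead
  -- of over list memberships.
  data Link : Vertex → Vertex → Set where
    spoke : ∀ m σ → Link (site m) (pole σ)
    chord : ∀ σ n {i l} → l ∈ stack i → Link (inside σ n i) (embed σ n l)

  link : ∀ u v → u ∈ parents v → Link v u
  link u (site m) u∈ with σ , _ , refl ← ∈-map⁻ pole u∈ = spoke m σ
  link u (inside σ n i) u∈ with l , l∈ , refl ← ∈-map⁻ (embed σ n) u∈ = chord σ n l∈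

  link-parents : ∀ {u v} → Link v u → u ∈ parents v
  link-parents (spoke m σ)    = ∈-map⁺ pole (∈-bools σ)
  link-parents (chord σ n l∈) = ∈-map⁺ (embed σ n) l∈

  linked : ∀ {u v} → Link v u → v ~ u
  linked l = inj₂ (link-parents l)

  ¬complete : ¬ IsComplete G
  ¬complete K with K (pole false) (pole true) (λ ())
  ... | inj₁ ()
  ... | inj₂ ()

  degree-≤ : ∀ v ns → (∀ {w} → v ~ w → w ∈ ns) → degree v ℕ.≤ length ns
  degree-≤ v ns h = unique-⊆-length (Unique.filter⁺ (v ~?_) (Graph.unique G))
    (λ w∈ → h (proj₂ (∈-filter⁻ (v ~?_) {xs = vertices} w∈)))

  -- An inner vertex is a parent only within its own unit, since `embed` sends the corners to poles
  -- and sites. The equation on `u` is an argument because `embed σ n l` does not unify with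
  -- `inside σ n j` until `l` is split.
  link-inner : ∀ {v u σ n j} → Link v u → u ≡ inside σ n j →
               ∃[ i ] v ≡ inside σ n i × inner j ∈ stack i
  link-inner (chord _ _ {l = apex}    _)  ()
  link-inner (chord _ _ {l = base _}  _)  ()
  link-inner (chord _ _ {l = inner _} l∈) refl = _ , refl , l∈

  -- The neighbours are the three parents and the far vertex stacked onto this one. The bound is the
  -- size of the list it will get: one tint and three shades.
  degree-near : ∀ σ n d → degree (inside σ n (near d)) ℕ.≤ 4
  degree-near σ n d = degree-≤ v (inside σ n (far d) ∷ parents v) neighbour
    where
    v = inside σ n (near d)
    neighbour : ∀ {w} → v ~ w → w ∈ inside σ n (far d) ∷ parents v
    neighbour (inj₂ w∈) = there w∈
    neighbour {w} (inj₁ v∈) with link-inner (link _ w v∈) refl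
    ... | hub    , refl , there (there (there ()))
    ... | near _ , refl , there (there (here ()))
    ... | far _  , refl , there (there (here refl)) = here refl

  degree-far : ∀ σ n d → degree (inside σ n (far d)) ℕ.≤ 3
  degree-far σ n d = degree-≤ v (parents v) neighbour
    where
    v = inside σ n (far d)
    neighbour : ∀ {w} → v ~ w → w ∈ parents v
    neighbour (inj₂ w∈) = w∈
    neighbour {w} (inj₁ v∈) with link-inner (link _ w v∈) refl
    ... | hub    , refl , there (there (there ()))
    ... | near _ , refl , there (there (here ()))
    ... | far _  , refl , there (there (here ()))

  -- 3-connectedness

  side-≢ : ∀ n d → side n d ≢ side n (not d)
  side-≢ n false eq = ℕ.<⇒≢ (ℕ.n<1+n (toℕ n)) (trans (sym (Fin.toℕ-inject₁ n)) (cong toℕ eq))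
  side-≢ n true  eq = side-≢ n false (sym eq)

  base-≢ : ∀ n d → site (side n d) ≢ site (side n (not d))
  base-≢ n d eq = side-≢ n d (site-injective eq)

  -- If all three lists met `X`, one common vertex from each would give three distinct elements of
  -- `X`. Applied to three paths that are disjoint apart from shared ends, this is the easy
  -- direction of Menger's theorem.
  three-avoid : ∀ {X P Q R : List Vertex} → length X ℕ.< 3 →
                (∀ {a b} → a ∈ P → b ∈ Q → a ≢ b) →
                (∀ {a b} → a ∈ P → b ∈ R → a ≢ b) →
                (∀ {a b} → a ∈ Q → b ∈ R → a ≢ b) →
                All (_∉ X) P ⊎ All (_∉ X) Q ⊎ All (_∉ X) R
  three-avoid {X} {P} {Q} {R} ∣X∣<3 PQ PR QR with avoid? P | avoid? Q | avoid? R
    where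
    avoid? : ∀ S → All (_∉ X) S ⊎ ∃[ s ] s ∈ S × s ∈ X
    avoid? S with all? (λ v → ¬? (v ∈? X)) S
    ... | yes S∉X = inj₁ S∉X
    ... | no ¬S∉X with any ← ¬All⇒Any¬ (λ v → ¬? (v ∈? X)) S ¬S∉X =
      inj₂ (Any.lookup any , ∈-lookup _ , decidable-stable (_ ∈? X) (lookup-index any))
  ... | inj₁ p | _      | _      = inj₁ p
  ... | inj₂ _ | inj₁ q | _      = inj₂ (inj₁ q)
  ... | inj₂ _ | inj₂ _ | inj₁ r = inj₂ (inj₂ r)
  ... | inj₂ (a , a∈P , a∈X) | inj₂ (b , b∈Q , b∈X) | inj₂ (c , c∈R , c∈X) =
    contradiction
      (unique-⊆-length {xs = a ∷ b ∷ c ∷ []} {X}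
        ((PQ a∈P b∈Q ∷ PR a∈P c∈R ∷ []) ∷ (QR b∈Q c∈R ∷ []) ∷ [] ∷ [])
        λ { (here refl) → a∈X ; (there (here refl)) → b∈X ; (there (there (here refl))) → c∈X })
      (ℕ.<⇒≱ ∣X∣<3)

  order>3 : 3 ℕ.< order
  order>3 = unique-⊆-length
    {xs = pole false ∷ pole true ∷ site zero ∷ site (suc zero) ∷ []}
    (((λ ()) ∷ (λ ()) ∷ (λ ()) ∷ []) ∷ ((λ ()) ∷ (λ ()) ∷ []) ∷ ((λ ()) ∷ []) ∷ [] ∷ [])
    (λ {v} _ → Graph.complete G v)

  module Removal (X : List Vertex) (∣X∣<3 : length X ℕ.< 3) where

    _⇝_ : Vertex → Vertex → Set
    _⇝_ = Star (λ x y → x ∉ X × y ∉ X × x ~ y)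

    hop : ∀ {u v} → u ∉ X → v ∉ X → u ~ v → u ⇝ v
    hop u∉ v∉ u~v = (u∉ , v∉ , u~v) ◅ ε

    ⇝-sym : ∀ {u v} → u ⇝ v → v ⇝ u
    ⇝-sym = reverse λ { {u} {v} (u∉ , v∉ , u~v) → v∉ , u∉ , ~-sym {u} {v} u~v }

    -- Connectivity is proved in two stages: every surviving vertex reaches a surviving pole or
    -- site, and all of these reach one root.
    Core : Vertex → Set
    Core c = (∃[ σ ] c ≡ pole σ) ⊎ (∃[ m ] c ≡ site m)

    ToCore : Vertex → Set
    ToCore v = ∃[ c ] Core c × c ∉ X × v ⇝ c

    -- An inner vertex has three paths to the corners of its unit that share no other vertex.
    to-core : ∀ v → v ∉ X → ToCore v
    to-core (pole σ) v∉ = pole σ , inj₁ (_ , refl) , v∉ , ε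
    to-core (site m) v∉ = site m , inj₂ (_ , refl) , v∉ , ε
    to-core (inside σ n i) v∉ = fan i v∉
      where
      at : Local → Vertex
      at = embed σ n

      edge : ∀ {i l} → l ∈ stack i → at (inner i) ~ at l
      edge l∈ = linked (chord σ n l∈)

      core : ∀ d → Core (at (base d))
      core d = inj₂ (_ , refl)

      via : ∀ {i l} → at (inner i) ∉ X → l ∈ stack i → Core (at l) →
            All (_∉ X) (at l ∷ []) → ToCore (at (inner i))
      via v∉ l∈ c (l∉ ∷ []) = _ , c , l∉ , hop v∉ l∉ (edge l∈)

      via₂ : ∀ {i j l} → at (inner i) ∉ X → inner j ∈ stack i → l ∈ stack j → Core (at l) →
             All (_∉ X) (at (inner j) ∷ at l ∷ []) → ToCore (at (inner i))
      via₂ v∉ j∈ l∈ c (j∉ ∷ l∉ ∷ []) =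
        _ , c , l∉ , hop v∉ j∉ (edge j∈) ◅◅ hop j∉ l∉ (edge l∈)

      other-base : ∀ d → base (not d) ∈ stack hub
      other-base false = there (there (here refl))
      other-base true  = there (here refl)

      fan : ∀ i → at (inner i) ∉ X → ToCore (at (inner i))
      fan hub v∉ with three-avoid {P = at apex ∷ []} {at (base false) ∷ []} {at (base true) ∷ []} ∣X∣<3
          (λ { (here refl) (here refl) () }) (λ { (here refl) (here refl) () })
          (λ { (here refl) (here refl) → base-≢ n false })
      ... | inj₁ p        = via v∉ (here refl) (inj₁ (_ , refl)) p
      ... | inj₂ (inj₁ p) = via v∉ (there (here refl)) (core false) p
      ... | inj₂ (inj₂ p) = via v∉ (there (there (here refl))) (core true) p
      fan (near d) v∉ with three-avoid
          {P = at apex ∷ []} {at (base d) ∷ []} {at (inner hub) ∷ at (base (not d)) ∷ []} ∣X∣<3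
          (λ { (here refl) (here refl) () })
          (λ { (here refl) (here refl) () ; (here refl) (there (here refl)) () })
          (λ { (here refl) (here refl) () ; (here refl) (there (here refl)) → base-≢ n d })
      ... | inj₁ p        = via v∉ (here refl) (inj₁ (_ , refl)) p
      ... | inj₂ (inj₁ p) = via v∉ (there (here refl)) (core d) p
      ... | inj₂ (inj₂ p) = via₂ v∉ (there (there (here refl))) (other-base d) (core (not d)) p
      fan (far d) v∉ with three-avoid
          {P = at (base d) ∷ []} {at (inner hub) ∷ at (base (not d)) ∷ []} {at (inner (near d)) ∷ at apex ∷ []}
          ∣X∣<3
          (λ { (here refl) (here refl) () ; (here refl) (there (here refl)) → base-≢ n d })
          (λ { (here refl) (here refl) () ; (here refl) (there (here refl)) () })
          (λ { (here refl) (here refl) () ; (here refl) (there (here refl)) ()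
             ; (there (here refl)) (here refl) () ; (there (here refl)) (there (here refl)) () })
      ... | inj₁ p        = via v∉ (here refl) (core d) p
      ... | inj₂ (inj₁ p) = via₂ v∉ (there (here refl)) (other-base d) (core (not d)) p
      ... | inj₂ (inj₂ p) = via₂ v∉ (there (there (here refl))) (here refl) (inj₁ (_ , refl)) p

    pole-site : ∀ σ m → pole σ ∉ X → site m ∉ X → site m ⇝ pole σ
    pole-site σ m σ∉ m∉ = hop m∉ σ∉ (linked (spoke m σ))

    -- Three sites are common neighbours of the poles, and at most two vertices are deleted. For `σ`
    -- equal to `τ` the path goes to a site and back.
    poles-joined : ∀ σ τ → pole σ ∉ X → pole τ ∉ X → pole τ ⇝ pole σ
    poles-joined σ τ σ∉ τ∉ with three-avoid
        {P = site zero ∷ []} {site (suc zero) ∷ []} {site (suc (suc zero)) ∷ []} ∣X∣<3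
        (λ { (here refl) (here refl) () }) (λ { (here refl) (here refl) () })
        (λ { (here refl) (here refl) () })
    ... | inj₁ (m∉ ∷ [])        = ⇝-sym (pole-site τ _ τ∉ m∉) ◅◅ pole-site σ _ σ∉ m∉
    ... | inj₂ (inj₁ (m∉ ∷ [])) = ⇝-sym (pole-site τ _ τ∉ m∉) ◅◅ pole-site σ _ σ∉ m∉
    ... | inj₂ (inj₂ (m∉ ∷ [])) = ⇝-sym (pole-site τ _ τ∉ m∉) ◅◅ pole-site σ _ σ∉ m∉

    Root : Set
    Root = ∃[ r ] (∀ c → Core c → c ∉ X → c ⇝ r)

    pole-root : ∀ σ → pole σ ∉ X → Root
    pole-root σ σ∉ = pole σ , λ where
      _ (inj₁ (τ , refl)) τ∉ → poles-joined σ τ σ∉ τ∉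
      _ (inj₂ (m , refl)) m∉ → pole-site σ m σ∉ m∉

    -- The poles exhaust `X`, so all sites and hubs survive, and one can walk along the row of sites
    -- through the hub of each gap.
    poles-removed-root : pole false ∈ X → pole true ∈ X → Root
    poles-removed-root f∈ t∈ = site zero , λ where
        _ (inj₁ (false , refl)) c∉ → contradiction f∈ c∉
        _ (inj₁ (true  , refl)) c∉ → contradiction t∈ c∉
        _ (inj₂ (m     , refl)) c∉ → <-weakInduction (λ m → site m ⇝ site zero) ε (λ n → next n ◅◅_) m
      where
      rest : ∀ {v} → (∀ σ → pole σ ≢ v) → v ∉ X
      rest {v} ≢v v∈ = contradiction
        (unique-⊆-length {xs = pole false ∷ pole true ∷ v ∷ []}
          (((λ ()) ∷ ≢v false ∷ []) ∷ (≢v true ∷ []) ∷ [] ∷ [])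
          λ { (here refl) → f∈ ; (there (here refl)) → t∈ ; (there (there (here refl))) → v∈ })
        (ℕ.<⇒≱ ∣X∣<3)
      site∉ : ∀ m → site m ∉ X
      site∉ m = rest λ _ ()
      next : ∀ n → site (suc n) ⇝ site (inject₁ n)
      next n = ⇝-sym (hop y∉ (site∉ (suc n)) (linked (chord false n (there (there (here refl))))))
            ◅◅ hop y∉ (site∉ (inject₁ n)) (linked (chord false n (there (here refl))))
        where
        y∉ : inside false n hub ∉ X
        y∉ = rest λ _ ()

    root : Root
    root with pole false ∈? X | pole true ∈? X
    ... | no f∉  | _      = pole-root false f∉
    ... | yes _  | no t∉  = pole-root true t∉
    ... | yes f∈ | yes t∈ = poles-removed-root f∈ t∈

    connected : ConnectedWithout G X
    connected u v u∉ v∉ =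
      let (c , c-core , c∉ , u⇝c) = to-core u u∉
          (d , d-core , d∉ , v⇝d) = to-core v v∉
          (r , to-root) = root
      in u⇝c ◅◅ to-root c c-core c∉ ◅◅ ⇝-sym (v⇝d ◅◅ to-root d d-core d∉)

  3-connected : IsConnected 3 G
  3-connected = order>3 , Removal.connected

-- The list assignment

-- The label of a site is a pair of pole colours and the place of the site among
-- the three consecutive sites that block this pair.
record Columns (p N : ℕ) : Set where
  field
    label        : Fin (3 ℕ.+ N) → (Fin p × Fin p) × Fin 3
    left right   : Fin p → Fin p → Fin (2 ℕ.+ N)
    adjacent     : ∀ i j → suc (left i j) ≡ inject₁ (right i j)
    label-left   : ∀ i j → label (inject₁ (left i j)) ≡ ((i , j) , zero)
    label-middle : ∀ i j → label (inject₁ (right i j)) ≡ ((i , j) , suc zero)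
    label-right  : ∀ i j → label (suc (right i j)) ≡ ((i , j) , suc (suc zero))

-- (false , h) stands for Tₕ and (true , h) for Dₕ.
Class : Set
Class = Bool × Bool

-- The two poles get disjoint palettes of seven tints; each of the four classes is a triple of
-- shades.
data Colour : Set where
  tint  : (σ : Bool) (i : Fin 7) → Colour
  shade : (b : Class) (k : Fin 3) → Colour

shades : List Class → List Colour
shades bs = cartesianProductWith shade bs (allFin 3)

shades-unique : ∀ {bs} → Unique bs → Unique (shades bs)
shades-unique u = Unique.cartesianProductWith⁺ shade (λ { refl → refl , refl }) u (Unique.allFin⁺ 3)

tint-shades-unique : ∀ {bs} σ i → Unique bs → Unique (tint σ i ∷ shades bs)
tint-shades-unique {bs} σ i u = All.tabulate tint≢ ∷ shades-unique u
  where
  tint≢ : ∀ {c} → c ∈ shades bs → tint σ i ≢ c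
  tint≢ c∈ eq with _ , _ , _ , _ , refl ← ∈-cartesianProductWith⁻ shade bs (allFin 3) c∈ with () ← eq

pair-unique : ∀ {b c : Class} → b ≢ c → Unique (b ∷ c ∷ [])
pair-unique b≢c = (b≢c ∷ []) ∷ [] ∷ []

∈-shades-pair : ∀ {b c x} → x ∈ shades (b ∷ c ∷ []) → x ∈ shades (b ∷ []) ⊎ x ∈ shades (c ∷ [])
∈-shades-pair {b} {c} x∈ with ∈-cartesianProductWith⁻ shade (b ∷ c ∷ []) (allFin 3) x∈
... | _ , k , here refl , _ , refl =
  inj₁ (∈-cartesianProductWith⁺ shade {xs = b ∷ []} (here refl) (∈-allFin k))
... | _ , k , there (here refl) , _ , refl =
  inj₂ (∈-cartesianProductWith⁺ shade {xs = c ∷ []} (here refl) (∈-allFin k))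

-- The outer two sites of a column use the triples T₀ and T₁, the middle one D₀ and D₁.
tier : Fin 3 → Bool
tier zero             = false
tier (suc zero)       = true
tier (suc (suc zero)) = false

-- The gap after the last site of a column (r = 2) plays no role; it is treated
-- like the gap before that site.
kills : Fin 3 → (σ d : Bool) → Class
kills zero    σ false = false , σ
kills zero    σ true  = true , false
kills (suc _) σ false = true , true
kills (suc _) σ true  = false , σ

kills-≢ : ∀ r σ → kills r σ false ≢ kills r σ true
kills-≢ zero    σ ()
kills-≢ (suc _) σ ()

tintAt : Fin 7 × Fin 7 → Bool → Colour
tintAt (i , j) false = tint false i
tintAt (i , j) true  = tint true j

tintAt-unique : ∀ {bs} ij σ → Unique bs → Unique (tintAt ij σ ∷ shades bs)
tintAt-unique (i , j) false = tint-shades-unique false i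
tintAt-unique (i , j) true  = tint-shades-unique true j

module _ {N : ℕ} (columns : Columns 7 N) where

  open Strip N
  open Graph G using (_~_; degree)
  open Columns columns

  colours : Vertex → List Colour
  colours (pole σ) = mapᴸ (tint σ) (allFin 7)
  colours (site m) = let (ij , r) = label m in
    -- The tint fills the list up to seven colours. It belongs to the pole `false`, a neighbour of
    -- every site, so it is lost once that pole takes it.
    tintAt ij false ∷ shades ((tier r , false) ∷ (tier r , true) ∷ [])
  colours (inside σ n i) = unit i
    where
    -- A unit takes its pair and its place from the site before its gap.
    ij = proj₁ (label (inject₁ n))
    r  = proj₂ (label (inject₁ n))
    unit : Inner → List Colour
    unit hub      = tintAt ij σ ∷ shades (kills r σ false ∷ kills r σ true ∷ [])
    unit (near d) = tintAt ij σ ∷ shades (kills r σ d ∷ [])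
    unit (far d)  = shades (kills r σ d ∷ [])

  colours-unique : ∀ v → Unique (colours v)
  colours-unique (pole σ)              = Unique.map⁺ {f = tint σ} (λ { refl → refl }) (Unique.allFin⁺ 7)
  colours-unique (site m)              = tintAt-unique (proj₁ (label m)) false (pair-unique λ ())
  colours-unique (inside σ n hub)      =
    tintAt-unique (proj₁ (label (inject₁ n))) σ (pair-unique (kills-≢ (proj₂ (label (inject₁ n))) σ))
  colours-unique (inside σ n (near d)) = tintAt-unique (proj₁ (label (inject₁ n))) σ ([] ∷ [])
  colours-unique (inside σ n (far d))  = shades-unique {bs = kills (proj₂ (label (inject₁ n))) σ d ∷ []} ([] ∷ [])

  L : ListAssignment G Colour
  L = record { colours = colours ; unique = colours-unique }

  -- Poles, sites and hubs have seven colours; near and far vertices have as many as the bounds on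
  -- their degrees, four and three.
  L-size : ∀ v → 7 ℕ.⊓ degree v ℕ.≤ ListAssignment.size L v
  L-size (pole σ)              = ℕ.m⊓n≤m 7 (degree (pole σ))
  L-size (site m)              = ℕ.m⊓n≤m 7 (degree (site m))
  L-size (inside σ n hub)      = ℕ.m⊓n≤m 7 (degree (inside σ n hub))
  L-size (inside σ n (near d)) = ℕ.≤-trans (ℕ.m⊓n≤n 7 (degree (inside σ n (near d)))) (degree-near σ n d)
  L-size (inside σ n (far d))  = ℕ.≤-trans (ℕ.m⊓n≤n 7 (degree (inside σ n (far d)))) (degree-far σ n d)

  -- Contradiction from a colouring

  module Colouring (φ : Vertex → Colour) (φ∈ : ∀ v → φ v ∈ colours v)
                   (proper : ∀ u v → u ~ v → φ u ≢ φ v) where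

    differs : ∀ {u v} → Link v u → φ v ≢ φ u
    differs {u} {v} l = proper v u (linked l)

    module _ (σ : Bool) (n : Gap) (pole≡ : φ (pole σ) ≡ tintAt (proj₁ (label (inject₁ n))) σ) where

      kill : Bool → Class
      kill = kills (proj₂ (label (inject₁ n))) σ

      not-tint : ∀ i → apex ∈ stack i → φ (inside σ n i) ≢ tintAt (proj₁ (label (inject₁ n))) σ
      not-tint i apex∈ eq = differs (chord σ n apex∈) (trans eq (sym pole≡))

      -- The base, hub, near and far vertices on the side `d` form a K₄. The near vertex has lost
      -- its tint to the pole, so all four colours would lie in one triple.
      hub-avoids : ∀ d → φ (site (side n d)) ∈ shades (kill d ∷ []) → φ (inside σ n hub) ∉ shades (kill d ∷ [])
      hub-avoids d z∈ h∈ = contradiction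
        (unique-⊆-length
          {xs = φ (site (side n d)) ∷ φ (inside σ n hub) ∷ φ (inside σ n (near d)) ∷ φ (inside σ n (far d)) ∷ []}
          {shades (kill d ∷ [])}
          ( (≢-sym (differs (hub-base d)) ∷ from (there (here refl)) ∷ from (here refl) ∷ [])
          ∷ (from (there (there (here refl))) ∷ from (there (here refl)) ∷ [])
          ∷ (from (there (there (here refl))) ∷ [])
          ∷ [] ∷ [])
          λ { (here refl) → z∈
            ; (there (here refl)) → h∈
            ; (there (there (here refl))) → Any.tail (not-tint (near d) (here refl)) (φ∈ (inside σ n (near d)))
            ; (there (there (there (here refl)))) → φ∈ (inside σ n (far d)) })
        λ { (s≤s (s≤s (s≤s ()))) }
        where
        hub-base : ∀ d → Link (inside σ n hub) (site (side n d))
        hub-base false = chord σ n (there (here refl))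
        hub-base true  = chord σ n (there (there (here refl)))
        from : ∀ {i l} → l ∈ stack i → φ (embed σ n l) ≢ φ (inside σ n i)
        from l∈ = ≢-sym (differs (chord σ n l∈))

      -- The hub has lost its tint to the pole too, so its colour lies in one of the two triples;
      -- `hub-avoids` rules out each.
      killed : φ (site (inject₁ n)) ∈ shades (kill false ∷ []) → φ (site (suc n)) ∉ shades (kill true ∷ [])
      killed l∈ r∈ = [ hub-avoids false l∈ , hub-avoids true r∈ ]′
        (∈-shades-pair {kill false} {kill true} (Any.tail (not-tint hub (here refl)) (φ∈ (inside σ n hub))))

    module _ (i j : Fin 7) (false≡ : φ (pole false) ≡ tint false i) (true≡ : φ (pole true) ≡ tint true j) where

      pole≡ : ∀ σ → φ (pole σ) ≡ tintAt (i , j) σ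
      pole≡ false = false≡
      pole≡ true  = true≡

      killed-at : ∀ n {r} → label (inject₁ n) ≡ ((i , j) , r) → ∀ σ →
                  φ (site (inject₁ n)) ∈ shades (kills r σ false ∷ []) →
                  φ (site (suc n)) ∉ shades (kills r σ true ∷ [])
      -- `h` is bound before rewriting so that the label in its type is replaced.
      killed-at n eq σ with h ← killed σ n rewrite eq = h (pole≡ σ)

      -- The only tint in the list is taken by the pole `false`, a neighbour; `h` tells which of the
      -- two remaining triples is used.
      site∈ : ∀ m {r} → label m ≡ ((i , j) , r) →
              ∃[ h ] φ (site m) ∈ shades ((tier r , h) ∷ [])
      site∈ m {r} eq with φ∈m ← φ∈ (site m) rewrite eq =
        [ false ,_ , true ,_ ]′ (∈-shades-pair {tier r , false} {tier r , true}
          (Any.tail (λ φ≡ → differs (spoke m false) (trans φ≡ (sym false≡))) φ∈m))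

      -- The colour of the middle site selects a gap, D₀ the left one and D₁ the right one. The
      -- outer site of that gap has a colour in some Tₕ, and the unit at the pole `h` forbids the
      -- combination.
      column-stuck : ⊥
      column-stuck with site∈ _ (label-left i j) | site∈ _ (label-middle i j) | site∈ _ (label-right i j)
      ... | h , l∈ | false , m∈ | _      =
        killed-at (left i j) (label-left i j) h l∈ (subst (λ m → φ (site m) ∈ _) (sym (adjacent i j)) m∈)
      ... | _      | true  , m∈ | h , r∈ = killed-at (right i j) (label-middle i j) h m∈ r∈

  ¬choosable : ¬ IsDegreeTruncatedChoosable 7 G
  ¬choosable choosable with φ , φ∈ , proper ← choosable L L-size
    with i , _ , false≡ ← ∈-map⁻ (tint false) (φ∈ (pole false))
       | j , _ , true≡ ← ∈-map⁻ (tint true) (φ∈ (pole true)) =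
    Colouring.column-stuck φ φ∈ proper i j false≡ true≡

-- Numbering the sites by columns

module _ {p N : ℕ} (size : (p ℕ.* p) ℕ.* 3 ≡ 3 ℕ.+ N) where

  -- Mixed-radix digits: site 3q + r has place r in column q, and q in turn encodes a pair of pole
  -- colours in base `p`.
  label : Fin (3 ℕ.+ N) → (Fin p × Fin p) × Fin 3
  label m = Product.map₁ (remQuot p) (remQuot 3 (Fin.cast (sym size) m))

  siteAt : Fin (p ℕ.* p) → Fin 3 → Fin (3 ℕ.+ N)
  siteAt q r = Fin.cast size (combine q r)

  label-siteAt : ∀ i j r → label (siteAt (combine i j) r) ≡ ((i , j) , r)
  label-siteAt i j r = begin
    Product.map₁ (remQuot p) (remQuot 3 (Fin.cast (sym size) (siteAt q r)))
      ≡⟨ cong (λ m → Product.map₁ (remQuot p) (remQuot 3 m)) (Fin.cast-involutive (sym size) size (combine q r)) ⟩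
    Product.map₁ (remQuot p) (remQuot 3 (combine q r))
      ≡⟨ cong (Product.map₁ (remQuot p)) (Fin.remQuot-combine q r) ⟩
    remQuot p q , r
      ≡⟨ cong (_, r) (Fin.remQuot-combine i j) ⟩
    (i , j) , r ∎
    where
    open ≡-Reasoning
    q = combine i j

  toℕ-siteAt : ∀ q r → toℕ (siteAt q r) ≡ 3 ℕ.* toℕ q ℕ.+ toℕ r
  toℕ-siteAt q r = trans (Fin.toℕ-cast size (combine q r)) (Fin.toℕ-combine q r)

  -- Consecutive places of a column have consecutive numbers, hence are the two ends of a gap.
  between : ∀ q (r : Fin 2) → ∃[ n ] suc n ≡ siteAt q (suc r) × inject₁ n ≡ siteAt q (inject₁ r)
  -- The equation makes the number of this site a successor, which leaves only the case `suc n`.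
  between q r with siteAt q (suc r) | trans (toℕ-siteAt q (suc r)) (ℕ.+-suc (3 ℕ.* toℕ q) (toℕ r))
  ... | suc n | h = n , refl , Fin.toℕ-injective (begin
    toℕ (inject₁ n)                 ≡⟨ Fin.toℕ-inject₁ n ⟩
    toℕ n                           ≡⟨ ℕ.suc-injective h ⟩
    3 ℕ.* toℕ q ℕ.+ toℕ r           ≡⟨ cong (3 ℕ.* toℕ q ℕ.+_) (Fin.toℕ-inject₁ r) ⟨
    3 ℕ.* toℕ q ℕ.+ toℕ (inject₁ r) ≡⟨ toℕ-siteAt q (inject₁ r) ⟨
    toℕ (siteAt q (inject₁ r))      ∎)
    where open ≡-Reasoning

  columns : Columns p N
  columns = record
    { label        = label
    ; left         = λ i j → gap i j zero
    ; right        = λ i j → gap i j (suc zero)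
    ; adjacent     = λ i j → trans (after i j zero) (sym (before i j (suc zero)))
    ; label-left   = λ i j → trans (cong label (before i j zero)) (label-siteAt i j _)
    ; label-middle = λ i j → trans (cong label (before i j (suc zero))) (label-siteAt i j _)
    ; label-right  = λ i j → trans (cong label (after i j (suc zero))) (label-siteAt i j _)
    }
    where
    gap : Fin p → Fin p → Fin 2 → Fin (2 ℕ.+ N)
    gap i j r = proj₁ (between (combine i j) r)
    after : ∀ i j r → suc (gap i j r) ≡ siteAt (combine i j) (suc r)
    after i j r = proj₁ (proj₂ (between (combine i j) r))
    before : ∀ i j r → inject₁ (gap i j r) ≡ siteAt (combine i j) (inject₁ r)
    before i j r = proj₂ (proj₂ (between (combine i j) r))

-- Segments in the plane

-- Compared as unnormalised rationals, since the sum in `ℚ` is normalised and does not reduce for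
-- variable numerators.
fromℤ-+ : ∀ i j → fromℤ (i ℤ.+ j) ≡ fromℤ i ℚ.+ fromℤ j
fromℤ-+ i j = ℚ.toℚᵘ-injective
  (ℚᵘ.≃-trans (ℚᵘ.*≡* (solve 2 (λ x y → (x :+ y) :* one := (x :* one :+ y :* one) :* one) refl i j))
              (ℚᵘ.≃-sym (ℚ.toℚᵘ-homo-+ (fromℤ i) (fromℤ j))))
  where
  open +-*-Solver
  one : ∀ {n} → Polynomial n
  one = con (+ 1)

fromℤ-* : ∀ i j → fromℤ (i ℤ.* j) ≡ fromℤ i ℚ.* fromℤ j
fromℤ-* i j = ℚ.toℚᵘ-injective
  (ℚᵘ.≃-trans (ℚᵘ.*≡* refl) (ℚᵘ.≃-sym (ℚ.toℚᵘ-homo-* (fromℤ i) (fromℤ j))))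

fromℤ-neg : ∀ i → fromℤ (ℤ.- i) ≡ ℚ.- fromℤ i
fromℤ-neg i = ℚ.toℚᵘ-injective (ℚᵘ.≃-sym (ℚ.toℚᵘ-homo‿- (fromℤ i)))

fromℤ-mono-≤ : ∀ {i j} → i ℤ.≤ j → fromℤ i ℚ.≤ fromℤ j
fromℤ-mono-≤ i≤j = ℚ.*≤* (ℤ.*-monoʳ-≤-nonNeg (+ 1) i≤j)

fromℤ-mono-< : ∀ {i j} → i ℤ.< j → fromℤ i ℚ.< fromℤ j
fromℤ-mono-< i<j = ℚ.*<* (ℤ.*-monoʳ-<-pos (+ 1) i<j)

-- One coordinate of the point at parameter `t`, definitionally as in `_∈[_,_]`.
lerp : ℚ → ℚ → ℚ → ℚ
lerp t x y = x ℚ.+ t ℚ.* (y ℚ.- x)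

UnitInterval : ℚ → Set
UnitInterval t = 0ℚ ℚ.≤ t × t ℚ.≤ 1ℚ

lerp-convex : ∀ t x y → lerp t x y ≡ (1ℚ ℚ.- t) ℚ.* x ℚ.+ t ℚ.* y
lerp-convex = solve 3 (λ t x y → x :+ t :* (y :- x) := (con 1ℚ :- t) :* x :+ t :* y) refl
  where open ℚSolver.+-*-Solver

*-nonNeg : ∀ {p q} → 0ℚ ℚ.≤ p → 0ℚ ℚ.≤ q → 0ℚ ℚ.≤ p ℚ.* q
*-nonNeg {p} {q} 0≤p 0≤q =
  subst (ℚ._≤ p ℚ.* q) (ℚ.*-zeroʳ p) (ℚ.*-monoˡ-≤-nonNeg p ⦃ ℚ.nonNegative 0≤p ⦄ 0≤q)

+-nonNeg : ∀ {p q} → 0ℚ ℚ.≤ p → 0ℚ ℚ.≤ q → 0ℚ ℚ.≤ p ℚ.+ q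
+-nonNeg = ℚ.+-mono-≤

nonNeg-sum-zeroˡ : ∀ {p q} → 0ℚ ℚ.≤ p → 0ℚ ℚ.≤ q → p ℚ.+ q ℚ.≤ 0ℚ → p ≡ 0ℚ
nonNeg-sum-zeroˡ {p} {q} 0≤p 0≤q p+q≤0 =
  ℚ.≤-antisym (ℚ.≤-trans (subst (ℚ._≤ p ℚ.+ q) (ℚ.+-identityʳ p) (ℚ.+-monoʳ-≤ p 0≤q)) p+q≤0) 0≤p

1-t-nonNeg : ∀ {t} → t ℚ.≤ 1ℚ → 0ℚ ℚ.≤ 1ℚ ℚ.- t
1-t-nonNeg {t} t≤1 = subst (ℚ._≤ 1ℚ ℚ.- t) (ℚ.+-inverseʳ t) (ℚ.+-monoˡ-≤ (ℚ.- t) t≤1)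

factor-zero : ∀ {p q} → 0ℚ ℚ.< q → p ℚ.* q ≡ 0ℚ → p ≡ 0ℚ
factor-zero {p} {q} 0<q pq≡0 =
  ℚ.≤-antisym (cancel (ℚ.≤-reflexive (trans pq≡0 (sym (ℚ.*-zeroˡ q)))))
              (cancel (ℚ.≤-reflexive (trans (ℚ.*-zeroˡ q) (sym pq≡0))))
  where
  cancel : ∀ {r s} → r ℚ.* q ℚ.≤ s ℚ.* q → r ℚ.≤ s
  cancel = ℚ.*-cancelʳ-≤-pos q ⦃ ℚ.positive 0<q ⦄

lerp-nonNeg : ∀ {t x y} → UnitInterval t → 0ℚ ℚ.≤ x → 0ℚ ℚ.≤ y → 0ℚ ℚ.≤ lerp t x y
lerp-nonNeg {t} {x} {y} (0≤t , t≤1) 0≤x 0≤y = subst (0ℚ ℚ.≤_) (sym (lerp-convex t x y))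
  (+-nonNeg (*-nonNeg (1-t-nonNeg t≤1) 0≤x) (*-nonNeg 0≤t 0≤y))

-- In the convex form both summands are nonnegative, so both vanish; an end with a positive value
-- must then have weight zero.
lerp-zero : ∀ {t x y} → UnitInterval t → 0ℚ ℚ.≤ x → 0ℚ ℚ.≤ y → lerp t x y ℚ.≤ 0ℚ →
            0ℚ ℚ.< x ⊎ 0ℚ ℚ.< y → t ≡ 1ℚ ⊎ t ≡ 0ℚ
lerp-zero {t} {x} {y} (0≤t , t≤1) 0≤x 0≤y l≤0 = map
  (λ 0<x → trans (solve 1 (λ s → s := con 1ℚ :- (con 1ℚ :- s)) refl t)
                 (cong (λ s → 1ℚ ℚ.- s) (factor-zero {1ℚ ℚ.- t} 0<x (nonNeg-sum-zeroˡ A B S))))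
  (λ 0<y → factor-zero 0<y (nonNeg-sum-zeroˡ B A (subst (ℚ._≤ 0ℚ) (ℚ.+-comm _ (t ℚ.* y)) S)))
  where
  open ℚSolver.+-*-Solver
  A = *-nonNeg (1-t-nonNeg t≤1) 0≤x
  B = *-nonNeg 0≤t 0≤y
  S = subst (ℚ._≤ 0ℚ) (lerp-convex t x y) l≤0

-- Vertices and separating lines have integer coordinates, so signs are decided over `ℤ` and carried
-- to the rational points of a segment by `⟪point⟫` and `⟪lerp⟫`.
Point² : Set
Point² = ℤ × ℤ

point : Point² → Point
point (x , y) = fromℤ x , fromℤ y

record Affine : Set where
  constructor affine
  field α β γ : ℤ

infixl 10 _⟨_⟩ _⟪_⟫

_⟨_⟩ : Affine → Point² → ℤ
affine α β γ ⟨ x , y ⟩ = α ℤ.* x ℤ.+ β ℤ.* y ℤ.+ γ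

_⟪_⟫ : Affine → Point → ℚ
affine α β γ ⟪ x , y ⟫ = fromℤ α ℚ.* x ℚ.+ fromℤ β ℚ.* y ℚ.+ fromℤ γ

-_ : Affine → Affine
- affine α β γ = affine (ℤ.- α) (ℤ.- β) (ℤ.- γ)

neg-⟨⟩ : ∀ F a → (- F) ⟨ a ⟩ ≡ ℤ.- (F ⟨ a ⟩)
neg-⟨⟩ (affine α β γ) (x , y) =
  solve 5 (λ α β γ x y → :- α :* x :+ :- β :* y :+ :- γ := :- (α :* x :+ β :* y :+ γ)) refl α β γ x y
  where open +-*-Solver

neg-⟪⟫ : ∀ F p → (- F) ⟪ p ⟫ ≡ ℚ.- (F ⟪ p ⟫)
neg-⟪⟫ (affine α β γ) (x , y)
  rewrite fromℤ-neg α | fromℤ-neg β | fromℤ-neg γ =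
    solve 5 (λ α β γ x y → :- α :* x :+ :- β :* y :+ :- γ := :- (α :* x :+ β :* y :+ γ)) refl
      (fromℤ α) (fromℤ β) (fromℤ γ) x y
  where open ℚSolver.+-*-Solver

⟪point⟫ : ∀ F a → F ⟪ point a ⟫ ≡ fromℤ (F ⟨ a ⟩)
⟪point⟫ (affine α β γ) (x , y) = sym (begin
  fromℤ (α ℤ.* x ℤ.+ β ℤ.* y ℤ.+ γ)
    ≡⟨ fromℤ-+ (α ℤ.* x ℤ.+ β ℤ.* y) γ ⟩
  fromℤ (α ℤ.* x ℤ.+ β ℤ.* y) ℚ.+ fromℤ γ
    ≡⟨ cong (ℚ._+ fromℤ γ) (fromℤ-+ (α ℤ.* x) (β ℤ.* y)) ⟩
  fromℤ (α ℤ.* x) ℚ.+ fromℤ (β ℤ.* y) ℚ.+ fromℤ γ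
    ≡⟨ cong (ℚ._+ fromℤ γ) (cong₂ ℚ._+_ (fromℤ-* α x) (fromℤ-* β y)) ⟩
  fromℤ α ℚ.* fromℤ x ℚ.+ fromℤ β ℚ.* fromℤ y ℚ.+ fromℤ γ ∎)
  where open ≡-Reasoning

⟪lerp⟫ : ∀ F p q t → F ⟪ lerp t (proj₁ p) (proj₁ q) , lerp t (proj₂ p) (proj₂ q) ⟫ ≡
                     lerp t (F ⟪ p ⟫) (F ⟪ q ⟫)
⟪lerp⟫ (affine α β γ) (x , y) (x′ , y′) t =
  solve 8 (λ α β γ x y x′ y′ t →
      α :* (x :+ t :* (x′ :- x)) :+ β :* (y :+ t :* (y′ :- y)) :+ γ
      := (α :* x :+ β :* y :+ γ) :+ t :* ((α :* x′ :+ β :* y′ :+ γ) :- (α :* x :+ β :* y :+ γ)))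
    refl (fromℤ α) (fromℤ β) (fromℤ γ) x y x′ y′ t
  where open ℚSolver.+-*-Solver

0≤⟪point⟫ : ∀ F a → 0ℤ ℤ.≤ F ⟨ a ⟩ → 0ℚ ℚ.≤ F ⟪ point a ⟫
0≤⟪point⟫ F a h = subst (0ℚ ℚ.≤_) (sym (⟪point⟫ F a)) (fromℤ-mono-≤ h)

0<⟪point⟫ : ∀ F a → 0ℤ ℤ.< F ⟨ a ⟩ → 0ℚ ℚ.< F ⟪ point a ⟫
0<⟪point⟫ F a h = subst (0ℚ ℚ.<_) (sym (⟪point⟫ F a)) (fromℤ-mono-< h)

lerp-start : ∀ x y → lerp 0ℚ x y ≡ x
lerp-start = solve 2 (λ x y → x :+ con 0ℚ :* (y :- x) := x) refl
  where open ℚSolver.+-*-Solver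

lerp-end : ∀ x y → lerp 1ℚ x y ≡ y
lerp-end = solve 2 (λ x y → x :+ con 1ℚ :* (y :- x) := y) refl
  where open ℚSolver.+-*-Solver

segment-nonNeg : ∀ F a b {p} → 0ℤ ℤ.≤ F ⟨ a ⟩ → 0ℤ ℤ.≤ F ⟨ b ⟩ →
                 p ∈[ point a , point b ] → 0ℚ ℚ.≤ F ⟪ p ⟫
segment-nonNeg F a b 0≤a 0≤b (t , 0≤t , t≤1 , refl) =
  subst (0ℚ ℚ.≤_) (sym (⟪lerp⟫ F (point a) (point b) t))
    (lerp-nonNeg (0≤t , t≤1) (0≤⟪point⟫ F a 0≤a) (0≤⟪point⟫ F b 0≤b))

segment-zero : ∀ F a b {p} → 0ℤ ℤ.≤ F ⟨ a ⟩ → 0ℤ ℤ.≤ F ⟨ b ⟩ → 0ℤ ℤ.< F ⟨ a ⟩ ⊎ 0ℤ ℤ.< F ⟨ b ⟩ →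
               p ∈[ point a , point b ] → F ⟪ p ⟫ ℚ.≤ 0ℚ → p ≡ point a ⊎ p ≡ point b
segment-zero F a b 0≤a 0≤b pos (t , 0≤t , t≤1 , refl) Fp≤0 =
  [ (λ { refl → inj₂ (cong₂ _,_ (lerp-end (fromℤ (proj₁ a)) _) (lerp-end (fromℤ (proj₂ a)) _)) })
  , (λ { refl → inj₁ (cong₂ _,_ (lerp-start _ (fromℤ (proj₁ b))) (lerp-start _ (fromℤ (proj₂ b)))) }) ]′
  (lerp-zero (0≤t , t≤1) (0≤⟪point⟫ F a 0≤a) (0≤⟪point⟫ F b 0≤b)
    (subst (ℚ._≤ 0ℚ) (⟪lerp⟫ F (point a) (point b) t) Fp≤0)
    (map (0<⟪point⟫ F a) (0<⟪point⟫ F b) pos))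

neg-nonNeg : ∀ F a → F ⟨ a ⟩ ℤ.≤ 0ℤ → 0ℤ ℤ.≤ (- F) ⟨ a ⟩
neg-nonNeg F a h = subst (0ℤ ℤ.≤_) (sym (neg-⟨⟩ F a)) (ℤ.neg-mono-≤ h)

neg-nonPos : ∀ F a → 0ℤ ℤ.≤ F ⟨ a ⟩ → (- F) ⟨ a ⟩ ℤ.≤ 0ℤ
neg-nonPos F a h = subst (ℤ._≤ 0ℤ) (sym (neg-⟨⟩ F a)) (ℤ.neg-mono-≤ h)

neg-pos : ∀ F a → F ⟨ a ⟩ ℤ.< 0ℤ → 0ℤ ℤ.< (- F) ⟨ a ⟩
neg-pos F a h = subst (0ℤ ℤ.<_) (sym (neg-⟨⟩ F a)) (ℤ.neg-mono-< h)

neg-neg : ∀ F a → 0ℤ ℤ.< F ⟨ a ⟩ → (- F) ⟨ a ⟩ ℤ.< 0ℤ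
neg-neg F a h = subst (ℤ._< 0ℤ) (sym (neg-⟨⟩ F a)) (ℤ.neg-mono-< h)

segment-nonPos : ∀ F a b {p} → F ⟨ a ⟩ ℤ.≤ 0ℤ → F ⟨ b ⟩ ℤ.≤ 0ℤ →
                 p ∈[ point a , point b ] → F ⟪ p ⟫ ℚ.≤ 0ℚ
segment-nonPos F a b {p} a≤0 b≤0 p∈ =
  subst (ℚ._≤ 0ℚ) (solve 1 (λ x → :- (:- x) := x) refl (F ⟪ p ⟫))
    (ℚ.neg-antimono-≤ (subst (0ℚ ℚ.≤_) (neg-⟪⟫ F p)
      (segment-nonNeg (- F) a b (neg-nonNeg F a a≤0) (neg-nonNeg F b b≤0) p∈)))
  where open ℚSolver.+-*-Solver

-- Strict positivity on one of the two segments is enough: a common point is a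
-- zero of F, hence an end of that segment.
record Separates (F : Affine) (a b c d : Point²) : Set where
  constructor separates
  field
    a≥0 : 0ℤ ℤ.≤ F ⟨ a ⟩
    b≥0 : 0ℤ ℤ.≤ F ⟨ b ⟩
    c≤0 : F ⟨ c ⟩ ℤ.≤ 0ℤ
    d≤0 : F ⟨ d ⟩ ℤ.≤ 0ℤ
    strict : (0ℤ ℤ.< F ⟨ a ⟩ ⊎ 0ℤ ℤ.< F ⟨ b ⟩) ⊎ (F ⟨ c ⟩ ℤ.< 0ℤ ⊎ F ⟨ d ⟩ ℤ.< 0ℤ)

Separated : (a b c d : Point²) → Set
Separated a b c d = ∃[ F ] Separates F a b c d

Separated-sym : ∀ {a b c d} → Separated a b c d → Separated c d a b
Separated-sym {a} {b} {c} {d} (F , separates a≥0 b≥0 c≤0 d≤0 strict) =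
  - F , separates (neg-nonNeg F c c≤0) (neg-nonNeg F d d≤0) (neg-nonPos F a a≥0) (neg-nonPos F b b≥0)
          (swap (map (map (neg-neg F a) (neg-neg F b)) (map (neg-pos F c) (neg-pos F d)) strict))

-- A common point lies in both closed half-planes, so `F` vanishes there and `segment-zero` applies
-- to the strict segment; if that is the second one, `F` is negated first.
separated-meet : ∀ {a b c d p} → Separated a b c d → p ∈[ point a , point b ] → p ∈[ point c , point d ] →
                 (p ≡ point a ⊎ p ≡ point b) ⊎ (p ≡ point c ⊎ p ≡ point d)
separated-meet {a} {b} {c} {d} {p} S@(F , separates a≥0 b≥0 c≤0 d≤0 strict) p∈ab p∈cd = map
  (λ pos → segment-zero F a b a≥0 b≥0 pos p∈ab (segment-nonPos F c d c≤0 d≤0 p∈cd))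
  (λ neg → let (_ , separates c≥0′ d≥0′ a≤0′ b≤0′ _) = Separated-sym S in
    segment-zero (- F) c d c≥0′ d≥0′ (map (neg-pos F c) (neg-pos F d) neg) p∈cd
      (segment-nonPos (- F) a b a≤0′ b≤0′ p∈ab))
  strict

record Excludes (F : Affine) (w a b : Point²) : Set where
  constructor excludes
  field
    w<0 : F ⟨ w ⟩ ℤ.< 0ℤ
    a≥0 : 0ℤ ℤ.≤ F ⟨ a ⟩
    b≥0 : 0ℤ ℤ.≤ F ⟨ b ⟩

Excluded : (w a b : Point²) → Set
Excluded w a b = ∃[ F ] Excludes F w a b

excluded-∉ : ∀ {w a b} → Excluded w a b → ¬ (point w ∈[ point a , point b ])
excluded-∉ {w} {a} {b} (F , excludes w<0 a≥0 b≥0) w∈ =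
  ℚ.<-irrefl refl (ℚ.<-≤-trans (subst (ℚ._< 0ℚ) (sym (⟪point⟫ F w)) (fromℤ-mono-< w<0))
                               (segment-nonNeg F a b a≥0 b≥0 w∈))

∈-segment-start : ∀ a b → a ∈[ a , b ]
∈-segment-start (x , y) (x′ , y′) =
  0ℚ , ℚ.≤-refl , ℚ.nonNegative⁻¹ 1ℚ , cong₂ _,_ (sym (lerp-start x x′)) (sym (lerp-start y y′))

-- The drawing

separates? : ∀ F a b c d → Dec (Separates F a b c d)
separates? F a b c d = map′
  (λ (p , q , r , s , t) → separates p q r s t)
  (λ (separates p q r s t) → p , q , r , s , t)
  ((0ℤ ℤ.≤? F ⟨ a ⟩) ×-dec (0ℤ ℤ.≤? F ⟨ b ⟩) ×-dec (F ⟨ c ⟩ ℤ.≤? 0ℤ) ×-dec (F ⟨ d ⟩ ℤ.≤? 0ℤ) ×-dec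
   (((0ℤ ℤ.<? F ⟨ a ⟩) ⊎-dec (0ℤ ℤ.<? F ⟨ b ⟩)) ⊎-dec ((F ⟨ c ⟩ ℤ.<? 0ℤ) ⊎-dec (F ⟨ d ⟩ ℤ.<? 0ℤ))))

excludes? : ∀ F w a b → Dec (Excludes F w a b)
excludes? F w a b = map′
  (λ (p , q , r) → excludes p q r) (λ (excludes p q r) → p , q , r)
  ((F ⟨ w ⟩ ℤ.<? 0ℤ) ×-dec (0ℤ ℤ.≤? F ⟨ a ⟩) ×-dec (0ℤ ℤ.≤? F ⟨ b ⟩))

-- Twice the signed area of the triangle spanned with the two given points.
line : Point² → Point² → Affine
line (x , y) (x′ , y′) = affine (y ℤ.- y′) (x′ ℤ.- x) (x ℤ.* y′ ℤ.- x′ ℤ.* y)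

-- Barycentric coordinates with respect to base true, apex, base false, scaled by 27;
-- every inner vertex is the centroid of its stack.
bary : Local → ℕ × ℕ × ℕ
bary apex                 = 0  , 27 , 0
bary (base false)         = 0  , 0  , 27
bary (base true)          = 27 , 0  , 0
bary (inner hub)          = 9  , 9  , 9
bary (inner (near false)) = 3  , 12 , 12
bary (inner (near true))  = 12 , 12 , 3
bary (inner (far false))  = 4  , 7  , 16
bary (inner (far true))   = 16 , 7  , 4

X Y W : Local → ℕ
X = proj₁ ∘ bary
Y = proj₁ ∘ proj₂ ∘ bary
W = proj₂ ∘ proj₂ ∘ bary

X+Y+W : ∀ l → + X l ℤ.+ + Y l ℤ.+ + W l ≡ + 27
X+Y+W apex                 = refl
X+Y+W (base false)         = refl
X+Y+W (base true)          = refl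
X+Y+W (inner hub)          = refl
X+Y+W (inner (near false)) = refl
X+Y+W (inner (near true))  = refl
X+Y+W (inner (far false))  = refl
X+Y+W (inner (far true))   = refl

-- Two barycentric coordinates suffice: `base false` becomes the origin, `base true` (27, 0) and
-- `apex` (0, 27).
locate : Local → Point²
locate l = + X l , + Y l

locals : List Local
locals = apex ∷ base false ∷ base true ∷ mapᴸ inner inners

∈-locals : ∀ l → l ∈ locals
∈-locals apex                 = here refl
∈-locals (base false)         = there (here refl)
∈-locals (base true)          = there (there (here refl))
∈-locals (inner hub)          = there (there (there (here refl)))
∈-locals (inner (near false)) = there (there (there (there (here refl))))
∈-locals (inner (near true))  = there (there (there (there (there (here refl)))))
∈-locals (inner (far false))  = there (there (there (there (there (there (here refl))))))
∈-locals (inner (far true))   = there (there (there (there (there (there (there (here refl)))))))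

-- Candidate separators. Each line through two local vertices occurs in both directions, hence with
-- both signs.
lines : List Affine
lines = cartesianProductWith (λ k l → line (locate k) (locate l)) locals locals

abstract

  -- A finite search within one unit; `abstract` keeps it from being unfolded where the result is
  -- used.
  chords-separated : All (λ i → All (λ k → All (λ j → All (λ l →
      (i ≡ j × k ≡ l) ⊎ Any (λ F → Separates F (locate (inner i)) (locate k) (locate (inner j)) (locate l)) lines)
    (stack j)) inners) (stack i)) inners
  chords-separated = from-yes
    (all? (λ i → all? (λ k → all? (λ j → all? (λ l →
      ((i ≟ⁱ j) ×-dec (k ≟ˡ l)) ⊎-dec
      any? (λ F → separates? F (locate (inner i)) (locate k) (locate (inner j)) (locate l)) lines)
    (stack j)) inners) (stack i)) inners)

  chords-clear : All (λ i → All (λ k → All (λ w →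
      w ≡ inner i ⊎ w ≡ k ⊎ Any (λ F → Excludes F (locate w) (locate (inner i)) (locate k)) lines)
    locals) (stack i)) inners
  chords-clear = from-yes
    (all? (λ i → all? (λ k → all? (λ w →
      (w ≟ˡ inner i) ⊎-dec (w ≟ˡ k) ⊎-dec
      any? (λ F → excludes? F (locate w) (locate (inner i)) (locate k)) lines)
    locals) (stack i)) inners)

sign : Bool → ℤ
sign false = + 1
sign true  = -[1+ 0 ]

≡+⇒0≤ : ∀ {v m} → v ≡ + m → 0ℤ ℤ.≤ v
≡+⇒0≤ refl = ℤ.+≤+ z≤n

≡+⇒0< : ∀ {v m} → v ≡ + m → 0 ℕ.< m → 0ℤ ℤ.< v
≡+⇒0< refl 0<m = ℤ.+<+ 0<m

≡-⇒≤0 : ∀ {v m} → v ≡ ℤ.- (+ m) → v ℤ.≤ 0ℤ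
≡-⇒≤0 refl = ℤ.neg-mono-≤ (ℤ.+≤+ z≤n)

≡-⇒<0 : ∀ {v m} → v ≡ ℤ.- (+ m) → 0 ℕ.< m → v ℤ.< 0ℤ
≡-⇒<0 refl 0<m = ℤ.neg-mono-< (ℤ.+<+ 0<m)

-- The shear (x , y) ↦ (x + k (27 − y) , ± y) fixes the pole and moves the base by 27 k;
-- here 27 − Y = X + W.
unitPosition : Bool → ℕ → Local → Point²
unitPosition σ k l = + X l ℤ.+ + k ℤ.* (+ X l ℤ.+ + W l) , sign σ ℤ.* + Y l

-- The x-axis separates the two poles and their units; the sign makes the side of `σ` positive.
height : Bool → Affine
height σ = affine 0ℤ (sign σ) 0ℤ

-- Vanishes on the line through the pole σ and the n-th site.
ray : Bool → ℕ → Affine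
ray σ n = affine (+ 1) (+ n ℤ.* sign σ) (ℤ.- (+ n ℤ.* + 27))

-- Composition with the inverse of the shear in unitPosition.
pull : Bool → ℕ → Affine → Affine
pull σ n (affine α β γ) =
  affine α (α ℤ.* (+ n ℤ.* sign σ) ℤ.+ β ℤ.* sign σ) (γ ℤ.- α ℤ.* (+ n ℤ.* + 27))

height-unit : ∀ σ k l → height σ ⟨ unitPosition σ k l ⟩ ≡ + Y l
height-unit false k l = solve 2 (λ x y → con 0ℤ :* x :+ con (+ 1) :* (con (+ 1) :* y) :+ con 0ℤ := y) refl
  (proj₁ (unitPosition false k l)) (+ Y l)
  where open +-*-Solver
height-unit true k l = solve 2 (λ x y → con 0ℤ :* x :+ con -[1+ 0 ] :* (con -[1+ 0 ] :* y) :+ con 0ℤ := y) refl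
  (proj₁ (unitPosition true k l)) (+ Y l)
  where open +-*-Solver

height-opposite : ∀ σ k l → height σ ⟨ unitPosition (not σ) k l ⟩ ≡ ℤ.- (+ Y l)
height-opposite false k l = solve 2 (λ x y → con 0ℤ :* x :+ con (+ 1) :* (con -[1+ 0 ] :* y) :+ con 0ℤ := :- y) refl
  (proj₁ (unitPosition true k l)) (+ Y l)
  where open +-*-Solver
height-opposite true k l = solve 2 (λ x y → con 0ℤ :* x :+ con -[1+ 0 ] :* (con (+ 1) :* y) :+ con 0ℤ := :- y) refl
  (proj₁ (unitPosition false k l)) (+ Y l)
  where open +-*-Solver

-- Writing the constant 27 as X + Y + W leaves a polynomial identity for each sign. The value is X
-- for k = n and -W for k = n - 1, so the ray bounds both neighbouring units.
ray-unit : ∀ σ n k l → ray σ n ⟨ unitPosition σ k l ⟩ ≡ + X l ℤ.+ (+ k ℤ.- + n) ℤ.* (+ X l ℤ.+ + W l)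
ray-unit σ n k l = trans
  (cong (λ D → + 1 ℤ.* proj₁ (unitPosition σ k l) ℤ.+ (+ n ℤ.* sign σ) ℤ.* (sign σ ℤ.* + Y l) ℤ.+ ℤ.- (+ n ℤ.* D))
        (sym (X+Y+W l)))
  (by-sign σ)
  where
  open +-*-Solver
  by-sign : ∀ σ → + 1 ℤ.* (+ X l ℤ.+ + k ℤ.* (+ X l ℤ.+ + W l)) ℤ.+ (+ n ℤ.* sign σ) ℤ.* (sign σ ℤ.* + Y l)
                    ℤ.+ ℤ.- (+ n ℤ.* (+ X l ℤ.+ + Y l ℤ.+ + W l))
                  ≡ + X l ℤ.+ (+ k ℤ.- + n) ℤ.* (+ X l ℤ.+ + W l)
  by-sign false = solve 5 (λ x y w k n → con (+ 1) :* (x :+ k :* (x :+ w)) :+ (n :* con (+ 1)) :* (con (+ 1) :* y)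
                    :+ :- (n :* (x :+ y :+ w)) := x :+ (k :- n) :* (x :+ w)) refl (+ X l) (+ Y l) (+ W l) (+ k) (+ n)
  by-sign true = solve 5 (λ x y w k n → con (+ 1) :* (x :+ k :* (x :+ w)) :+ (n :* con -[1+ 0 ]) :* (con -[1+ 0 ] :* y)
                    :+ :- (n :* (x :+ y :+ w)) := x :+ (k :- n) :* (x :+ w)) refl (+ X l) (+ Y l) (+ W l) (+ k) (+ n)

pull-unit : ∀ σ n F l → pull σ n F ⟨ unitPosition σ n l ⟩ ≡ F ⟨ locate l ⟩
pull-unit σ n (affine α β γ) l = trans
  (cong (λ D → α ℤ.* proj₁ (unitPosition σ n l) ℤ.+ (α ℤ.* (+ n ℤ.* sign σ) ℤ.+ β ℤ.* sign σ) ℤ.* (sign σ ℤ.* + Y l)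
                 ℤ.+ (γ ℤ.- α ℤ.* (+ n ℤ.* D)))
        (sym (X+Y+W l)))
  (by-sign σ)
  where
  open +-*-Solver
  by-sign : ∀ σ → α ℤ.* (+ X l ℤ.+ + n ℤ.* (+ X l ℤ.+ + W l))
                    ℤ.+ (α ℤ.* (+ n ℤ.* sign σ) ℤ.+ β ℤ.* sign σ) ℤ.* (sign σ ℤ.* + Y l)
                    ℤ.+ (γ ℤ.- α ℤ.* (+ n ℤ.* (+ X l ℤ.+ + Y l ℤ.+ + W l)))
                  ≡ α ℤ.* + X l ℤ.+ β ℤ.* + Y l ℤ.+ γ
  by-sign false = solve 7 (λ α β γ x y w n →
      α :* (x :+ n :* (x :+ w)) :+ (α :* (n :* con (+ 1)) :+ β :* con (+ 1)) :* (con (+ 1) :* y)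
        :+ (γ :- α :* (n :* (x :+ y :+ w))) := α :* x :+ β :* y :+ γ)
    refl α β γ (+ X l) (+ Y l) (+ W l) (+ n)
  by-sign true = solve 7 (λ α β γ x y w n →
      α :* (x :+ n :* (x :+ w)) :+ (α :* (n :* con -[1+ 0 ]) :+ β :* con -[1+ 0 ]) :* (con -[1+ 0 ] :* y)
        :+ (γ :- α :* (n :* (x :+ y :+ w))) := α :* x :+ β :* y :+ γ)
    refl α β γ (+ X l) (+ Y l) (+ W l) (+ n)

-- For k = n + d the value is X + d (X + W); having X as a summand makes it positive at inner
-- vertices.
ray-unit-≥ : ∀ σ {n k} l → n ℕ.≤ k → ∃[ e ] ray σ n ⟨ unitPosition σ k l ⟩ ≡ + (X l ℕ.+ e)
ray-unit-≥ σ {n} l n≤k with d , refl ← ℕ.m≤n⇒∃[o]m+o≡n n≤k = d ℕ.* (X l ℕ.+ W l) , (begin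
  ray σ n ⟨ unitPosition σ (n ℕ.+ d) l ⟩
    ≡⟨ ray-unit σ n (n ℕ.+ d) l ⟩
  + X l ℤ.+ (+ n ℤ.+ + d ℤ.- + n) ℤ.* (+ X l ℤ.+ + W l)
    ≡⟨ solve 4 (λ x w n d → x :+ (n :+ d :- n) :* (x :+ w) := x :+ d :* (x :+ w)) refl (+ X l) (+ W l) (+ n) (+ d) ⟩
  + X l ℤ.+ + d ℤ.* + (X l ℕ.+ W l)
    ≡⟨ cong (λ e → + X l ℤ.+ e) (ℤ.pos-* d (X l ℕ.+ W l)) ⟨
  + (X l ℕ.+ d ℕ.* (X l ℕ.+ W l)) ∎)
  where
  open ≡-Reasoning
  open +-*-Solver

-- For n = k + 1 + d the value is -(W + d (X + W)), so W supplies strictness on this side.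
ray-unit-≤ : ∀ σ {n k} l → k ℕ.< n → ∃[ e ] ray σ n ⟨ unitPosition σ k l ⟩ ≡ ℤ.- (+ (W l ℕ.+ e))
ray-unit-≤ σ {_} {k} l k<n with d , refl ← ℕ.m≤n⇒∃[o]m+o≡n k<n = d ℕ.* (X l ℕ.+ W l) , (begin
  ray σ (ℕ.suc k ℕ.+ d) ⟨ unitPosition σ k l ⟩
    ≡⟨ ray-unit σ (ℕ.suc k ℕ.+ d) k l ⟩
  + X l ℤ.+ (+ k ℤ.- (+ 1 ℤ.+ + k ℤ.+ + d)) ℤ.* (+ X l ℤ.+ + W l)
    ≡⟨ solve 4 (λ x w k d → x :+ (k :- (con (+ 1) :+ k :+ d)) :* (x :+ w) := :- (w :+ d :* (x :+ w))) refl
         (+ X l) (+ W l) (+ k) (+ d) ⟩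
  ℤ.- (+ W l ℤ.+ + d ℤ.* + (X l ℕ.+ W l))
    ≡⟨ cong (λ e → ℤ.- (+ W l ℤ.+ e)) (ℤ.pos-* d (X l ℕ.+ W l)) ⟨
  ℤ.- (+ (W l ℕ.+ d ℕ.* (X l ℕ.+ W l))) ∎)
  where
  open ≡-Reasoning
  open +-*-Solver

0<X : ∀ i → 0 ℕ.< X (inner i)
0<X hub          = s≤s z≤n
0<X (near false) = s≤s z≤n
0<X (near true)  = s≤s z≤n
0<X (far false)  = s≤s z≤n
0<X (far true)   = s≤s z≤n

0<Y : ∀ i → 0 ℕ.< Y (inner i)
0<Y hub          = s≤s z≤n
0<Y (near false) = s≤s z≤n
0<Y (near true)  = s≤s z≤n
0<Y (far false)  = s≤s z≤n
0<Y (far true)   = s≤s z≤n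

0<W : ∀ i → 0 ℕ.< W (inner i)
0<W hub          = s≤s z≤n
0<W (near false) = s≤s z≤n
0<W (near true)  = s≤s z≤n
0<W (far false)  = s≤s z≤n
0<W (far true)   = s≤s z≤n

-- Separating lines in the whole drawing

module Drawing (N : ℕ) where

  open Strip N
  open Graph G using (_~_)

  place : Vertex → Point²
  place (pole σ)       = 0ℤ , sign σ ℤ.* + 27
  place (site m)       = + toℕ m ℤ.* + 27 , 0ℤ
  place (inside σ n i) = unitPosition σ (toℕ n) (inner i)

  -- The sheared units agree on their shared corners: the pole is fixed, and the bases of gap n land
  -- on the sites n and n + 1.
  place-embed : ∀ σ n l → place (embed σ n l) ≡ unitPosition σ (toℕ n) l
  place-embed σ n apex         = cong (_, _) (sym (trans (ℤ.+-identityˡ _) (ℤ.*-zeroʳ (+ toℕ n))))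
  place-embed σ n (base false) = cong₂ _,_
    (trans (cong (λ k → + k ℤ.* + 27) (Fin.toℕ-inject₁ n)) (sym (ℤ.+-identityˡ _))) (sym (ℤ.*-zeroʳ (sign σ)))
  place-embed σ n (base true)  = cong₂ _,_ (ℤ.suc-* (+ toℕ n) (+ 27)) (sym (ℤ.*-zeroʳ (sign σ)))
  place-embed σ n (inner i)    = refl

  height-pole : ∀ σ → 0ℤ ℤ.< height σ ⟨ place (pole σ) ⟩
  height-pole false = ℤ.+<+ (s≤s z≤n)
  height-pole true  = ℤ.+<+ (s≤s z≤n)

  height-pole⁻ : ∀ σ → height σ ⟨ place (pole (not σ)) ⟩ ℤ.< 0ℤ
  height-pole⁻ false = ℤ.-<+
  height-pole⁻ true  = ℤ.-<+

  ray-pole : ∀ σ n → ray σ n ⟨ place (pole σ) ⟩ ≡ 0ℤ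
  ray-pole false n = solve 1 (λ n →
      con (+ 1) :* con 0ℤ :+ (n :* con (+ 1)) :* con (+ 27) :+ :- (n :* con (+ 27)) := con 0ℤ)
    refl (+ n)
    where open +-*-Solver
  ray-pole true n = solve 1 (λ n →
      con (+ 1) :* con 0ℤ :+ (n :* con -[1+ 0 ]) :* con -[1+ 26 ] :+ :- (n :* con (+ 27)) := con 0ℤ)
    refl (+ n)
    where open +-*-Solver

  module _ (σ : Bool) where

    height-site : ∀ m → height σ ⟨ place (site m) ⟩ ≡ 0ℤ
    height-site m = solve 2 (λ x s → con 0ℤ :* x :+ s :* con 0ℤ :+ con 0ℤ := con 0ℤ) refl (+ toℕ m ℤ.* + 27) (sign σ)
      where open +-*-Solver

    height-site-≥ : ∀ m → 0ℤ ℤ.≤ height σ ⟨ place (site m) ⟩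
    height-site-≥ m = ℤ.≤-reflexive (sym (height-site m))

    height-site-≤ : ∀ m → height σ ⟨ place (site m) ⟩ ℤ.≤ 0ℤ
    height-site-≤ m = ℤ.≤-reflexive (height-site m)

    height-embed : ∀ n l → 0ℤ ℤ.≤ height σ ⟨ place (embed σ n l) ⟩
    height-embed n l rewrite place-embed σ n l = ≡+⇒0≤ (height-unit σ (toℕ n) l)

    height-inside : ∀ n i → 0ℤ ℤ.< height σ ⟨ place (inside σ n i) ⟩
    height-inside n i = ≡+⇒0< (height-unit σ (toℕ n) (inner i)) (0<Y i)

    height-embed⁻ : ∀ n l → height σ ⟨ place (embed (not σ) n l) ⟩ ℤ.≤ 0ℤ
    height-embed⁻ n l rewrite place-embed (not σ) n l = ≡-⇒≤0 (height-opposite σ (toℕ n) l)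

    height-inside⁻ : ∀ n i → height σ ⟨ place (inside (not σ) n i) ⟩ ℤ.< 0ℤ
    height-inside⁻ n i = ≡-⇒<0 (height-opposite σ (toℕ n) (inner i)) (0<Y i)

    ray-site : ∀ n m → ray σ n ⟨ place (site m) ⟩ ≡ (+ toℕ m ℤ.- + n) ℤ.* + 27
    ray-site n m = solve 3 (λ m n s → con (+ 1) :* (m :* con (+ 27)) :+ (n :* s) :* con 0ℤ :+ :- (n :* con (+ 27))
                             := (m :- n) :* con (+ 27)) refl (+ toℕ m) (+ n) (sign σ)
      where open +-*-Solver

    ray-site-≡ : ∀ m → ray σ (toℕ m) ⟨ place (site m) ⟩ ≡ 0ℤ
    ray-site-≡ m = trans (ray-site (toℕ m) m) (cong (ℤ._* + 27) (ℤ.+-inverseʳ (+ toℕ m)))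

    ray-site-> : ∀ {n m} → n ℕ.< toℕ m → 0ℤ ℤ.< ray σ n ⟨ place (site m) ⟩
    ray-site-> {n} {m} n<m = subst (0ℤ ℤ.<_) (sym (ray-site n m))
      (ℤ.*-monoʳ-<-pos (+ 27) (subst (ℤ._< + toℕ m ℤ.- + n) (ℤ.+-inverseʳ (+ n)) (ℤ.+-monoˡ-< (ℤ.- + n) (ℤ.+<+ n<m))))

    ray-site-< : ∀ {n m} → toℕ m ℕ.< n → ray σ n ⟨ place (site m) ⟩ ℤ.< 0ℤ
    ray-site-< {n} {m} m<n = subst (ℤ._< 0ℤ) (sym (ray-site n m))
      (ℤ.*-monoʳ-<-pos (+ 27) (subst (+ toℕ m ℤ.- + n ℤ.<_) (ℤ.+-inverseʳ (+ n)) (ℤ.+-monoˡ-< (ℤ.- + n) (ℤ.+<+ m<n))))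

    ray-embed-≥ : ∀ {n} k l → n ℕ.≤ toℕ k → 0ℤ ℤ.≤ ray σ n ⟨ place (embed σ k l) ⟩
    ray-embed-≥ k l n≤k rewrite place-embed σ k l = ≡+⇒0≤ (proj₂ (ray-unit-≥ σ l n≤k))

    ray-inside-> : ∀ {n} k i → n ℕ.≤ toℕ k → 0ℤ ℤ.< ray σ n ⟨ place (inside σ k i) ⟩
    ray-inside-> k i n≤k = ≡+⇒0< (proj₂ (ray-unit-≥ σ (inner i) n≤k)) (ℕ.≤-trans (0<X i) (ℕ.m≤m+n _ _))

    ray-embed-≤ : ∀ {n} k l → toℕ k ℕ.< n → ray σ n ⟨ place (embed σ k l) ⟩ ℤ.≤ 0ℤ
    ray-embed-≤ k l k<n rewrite place-embed σ k l = ≡-⇒≤0 (proj₂ (ray-unit-≤ σ l k<n))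

    ray-inside-< : ∀ {n} k i → toℕ k ℕ.< n → ray σ n ⟨ place (inside σ k i) ⟩ ℤ.< 0ℤ
    ray-inside-< k i k<n = ≡-⇒<0 (proj₂ (ray-unit-≤ σ (inner i) k<n)) (ℕ.≤-trans (0<W i) (ℕ.m≤m+n _ _))

    pull-embed : ∀ n F l → F ⟨ locate l ⟩ ≡ pull σ (toℕ n) F ⟨ place (embed σ n l) ⟩
    pull-embed n F l rewrite place-embed σ n l = sym (pull-unit σ (toℕ n) F l)

  Sep : (u v x y : Vertex) → Set
  Sep u v x y = Separated (place u) (place v) (place x) (place y)

  Exc : (w u v : Vertex) → Set
  Exc w u v = Excluded (place w) (place u) (place v)

  -- `pull` takes at each vertex of the unit the value of `F` at its local place, so all signs carry
  -- over.
  pull-separated : ∀ σ n a b c d {F} → Separates F (locate a) (locate b) (locate c) (locate d) →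
                   Sep (embed σ n a) (embed σ n b) (embed σ n c) (embed σ n d)
  pull-separated σ n a b c d {F} (separates a≥0 b≥0 c≤0 d≤0 strict) = pull σ (toℕ n) F , separates
    (subst (0ℤ ℤ.≤_) (eq a) a≥0) (subst (0ℤ ℤ.≤_) (eq b) b≥0)
    (subst (ℤ._≤ 0ℤ) (eq c) c≤0) (subst (ℤ._≤ 0ℤ) (eq d) d≤0)
    (map (map (subst (0ℤ ℤ.<_) (eq a)) (subst (0ℤ ℤ.<_) (eq b)))
         (map (subst (ℤ._< 0ℤ) (eq c)) (subst (ℤ._< 0ℤ) (eq d))) strict)
    where
    eq : ∀ l → F ⟨ locate l ⟩ ≡ pull σ (toℕ n) F ⟨ place (embed σ n l) ⟩
    eq = pull-embed σ n F

  pull-excluded : ∀ σ n w a b {F} → Excludes F (locate w) (locate a) (locate b) →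
                  Exc (embed σ n w) (embed σ n a) (embed σ n b)
  pull-excluded σ n w a b {F} (excludes w<0 a≥0 b≥0) = pull σ (toℕ n) F , excludes
    (subst (ℤ._< 0ℤ) (eq w) w<0) (subst (0ℤ ℤ.≤_) (eq a) a≥0) (subst (0ℤ ℤ.≤_) (eq b) b≥0)
    where
    eq : ∀ l → F ⟨ locate l ⟩ ≡ pull σ (toℕ n) F ⟨ place (embed σ n l) ⟩
    eq = pull-embed σ n F

  Sep-sym : ∀ u v x y → Sep u v x y → Sep x y u v
  Sep-sym u v x y = Separated-sym {place u} {place v} {place x} {place y}

  -- The ray contains the later spoke and has the site of the earlier one strictly on its negative
  -- side.
  spokes-separated : ∀ σ {m m′} → toℕ m ℕ.< toℕ m′ → Sep (site m′) (pole σ) (site m) (pole σ)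
  spokes-separated σ {m} {m′} m<m′ = ray σ (toℕ m′) , separates
    (ℤ.≤-reflexive (sym (ray-site-≡ σ m′))) (ℤ.≤-reflexive (sym (ray-pole σ (toℕ m′))))
    (ℤ.<⇒≤ (ray-site-< σ m<m′)) (ℤ.≤-reflexive (ray-pole σ (toℕ m′)))
    (inj₂ (inj₁ (ray-site-< σ m<m′)))

  -- For opposite poles the x-axis separates. For the same pole the line of the spoke does, with the
  -- unit on its positive side exactly when m ≤ n.
  chord-spoke-separated : ∀ σ n i l m τ → Sep (inside σ n i) (embed σ n l) (site m) (pole τ)
  chord-spoke-separated σ n i l m τ with τ Bool.≟ σ
  ... | no τ≢σ rewrite Bool.¬-not τ≢σ = height σ , separates
    (ℤ.<⇒≤ (height-inside σ n i)) (height-embed σ n l) (height-site-≤ σ m) (ℤ.<⇒≤ (height-pole⁻ σ))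
    (inj₁ (inj₁ (height-inside σ n i)))
  ... | yes refl with ℕ.≤-<-connex (toℕ m) (toℕ n)
  ...   | inj₁ m≤n = ray σ (toℕ m) , separates
    (ℤ.<⇒≤ (ray-inside-> σ n i m≤n)) (ray-embed-≥ σ n l m≤n)
    (ℤ.≤-reflexive (ray-site-≡ σ m)) (ℤ.≤-reflexive (ray-pole σ (toℕ m)))
    (inj₁ (inj₁ (ray-inside-> σ n i m≤n)))
  ...   | inj₂ n<m = Sep-sym (site m) (pole σ) (inside σ n i) (embed σ n l) (ray σ (toℕ m) , separates
    (ℤ.≤-reflexive (sym (ray-site-≡ σ m))) (ℤ.≤-reflexive (sym (ray-pole σ (toℕ m))))
    (ℤ.<⇒≤ (ray-inside-< σ n i n<m)) (ray-embed-≤ σ n l n<m)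
    (inj₂ (inj₁ (ray-inside-< σ n i n<m))))

  -- The ray along the left side of the later unit has every earlier unit on its other side.
  units-separated : ∀ σ {n n′} i l j k → toℕ n ℕ.< toℕ n′ →
                    Sep (inside σ n′ i) (embed σ n′ l) (inside σ n j) (embed σ n k)
  units-separated σ {n} {n′} i l j k n<n′ = ray σ (toℕ n′) , separates
    (ℤ.<⇒≤ (ray-inside-> σ n′ i ℕ.≤-refl)) (ray-embed-≥ σ n′ l ℕ.≤-refl)
    (ℤ.<⇒≤ (ray-inside-< σ n j n<n′)) (ray-embed-≤ σ n k n<n′)
    (inj₂ (inj₁ (ray-inside-< σ n j n<n′)))

  -- The x-axis handles opposite poles and the rays handle spokes and different gaps; only two edges
  -- inside one unit need the computed table.
  links-separated : ∀ {u v x y} → Link u v → Link x y → (u ≡ x × v ≡ y) ⊎ Sep u v x y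
  links-separated (spoke m σ) (spoke m′ τ) with τ Bool.≟ σ
  ... | no τ≢σ rewrite Bool.¬-not τ≢σ = inj₂ (height σ , separates
    (height-site-≥ σ m) (ℤ.<⇒≤ (height-pole σ)) (height-site-≤ σ m′) (ℤ.<⇒≤ (height-pole⁻ σ))
    (inj₁ (inj₂ (height-pole σ))))
  ... | yes refl with Fin.<-cmp m m′
  ...   | tri< m<m′ _ _ = inj₂ (Sep-sym (site m′) (pole σ) (site m) (pole σ) (spokes-separated σ m<m′))
  ...   | tri≈ _ refl _ = inj₁ (refl , refl)
  ...   | tri> _ _ m′<m = inj₂ (spokes-separated σ m′<m)
  links-separated (chord σ n {i} {l} _) (spoke m τ) = inj₂ (chord-spoke-separated σ n i l m τ)
  links-separated (spoke m τ) (chord σ n {i} {l} _) = 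
    inj₂ (Sep-sym (inside σ n i) (embed σ n l) (site m) (pole τ) (chord-spoke-separated σ n i l m τ))
  links-separated (chord σ n {i} {l} l∈) (chord τ n′ {j} {k} k∈) with τ Bool.≟ σ
  ... | no τ≢σ rewrite Bool.¬-not τ≢σ = inj₂ (height σ , separates
    (ℤ.<⇒≤ (height-inside σ n i)) (height-embed σ n l) (ℤ.<⇒≤ (height-inside⁻ σ n′ j)) (height-embed⁻ σ n′ k)
    (inj₁ (inj₁ (height-inside σ n i))))
  ... | yes refl with Fin.<-cmp n n′
  ...   | tri< n<n′ _ _ =
    inj₂ (Sep-sym (inside σ n′ j) (embed σ n′ k) (inside σ n i) (embed σ n l) (units-separated σ j k i l n<n′))
  ...   | tri> _ _ n′<n = inj₂ (units-separated σ i l j k n′<n)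
  ...   | tri≈ _ refl _
    with All.lookup (All.lookup (All.lookup (All.lookup chords-separated (∈-inners i)) l∈) (∈-inners j)) k∈
  ...     | inj₁ (refl , refl) = inj₁ (refl , refl)
  ...     | inj₂ found = inj₂ (pull-separated σ n (inner i) l (inner j) k (proj₂ (satisfied found)))

  embed-clear : ∀ σ n {i l} → l ∈ stack i → ∀ w →
                embed σ n w ≡ inside σ n i ⊎ embed σ n w ≡ embed σ n l ⊎
                Exc (embed σ n w) (inside σ n i) (embed σ n l)
  embed-clear σ n {i} {l} l∈ w with All.lookup (All.lookup (All.lookup chords-clear (∈-inners i)) l∈) (∈-locals w)
  ... | inj₁ refl         = inj₁ refl
  ... | inj₂ (inj₁ refl)  = inj₂ (inj₁ refl)
  ... | inj₂ (inj₂ found) = inj₂ (inj₂ (pull-excluded σ n w (inner i) l (proj₂ (satisfied found))))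

  beyond : ∀ F w u v → 0ℤ ℤ.< F ⟨ place w ⟩ → F ⟨ place u ⟩ ℤ.≤ 0ℤ → F ⟨ place v ⟩ ℤ.≤ 0ℤ → Exc w u v
  beyond F w u v w>0 u≤0 v≤0 =
    - F , excludes (neg-neg F (place w) w>0) (neg-nonNeg F (place u) u≤0) (neg-nonNeg F (place v) v≤0)

  link-clear : ∀ {u v} → Link u v → ∀ w → w ≡ u ⊎ w ≡ v ⊎ Exc w u v
  link-clear (spoke m σ) (pole τ) with τ Bool.≟ σ
  ... | yes refl = inj₂ (inj₁ refl)
  ... | no τ≢σ rewrite Bool.¬-not τ≢σ = inj₂ (inj₂ (height σ , excludes
    (height-pole⁻ σ) (height-site-≥ σ m) (ℤ.<⇒≤ (height-pole σ))))
  link-clear (spoke m σ) (site k) with Fin.<-cmp k m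
  ... | tri< k<m _ _ = inj₂ (inj₂ (ray σ (toℕ m) , excludes
    (ray-site-< σ k<m) (ℤ.≤-reflexive (sym (ray-site-≡ σ m))) (ℤ.≤-reflexive (sym (ray-pole σ (toℕ m))))))
  ... | tri≈ _ refl _ = inj₁ refl
  ... | tri> _ _ m<k = inj₂ (inj₂ (beyond (ray σ (toℕ m)) (site k) (site m) (pole σ)
    (ray-site-> σ m<k) (ℤ.≤-reflexive (ray-site-≡ σ m)) (ℤ.≤-reflexive (ray-pole σ (toℕ m)))))
  link-clear (spoke m σ) (inside τ n i) with τ Bool.≟ σ
  ... | no τ≢σ rewrite Bool.¬-not τ≢σ = inj₂ (inj₂ (height σ , excludes
    (height-inside⁻ σ n i) (height-site-≥ σ m) (ℤ.<⇒≤ (height-pole σ))))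
  ... | yes refl with ℕ.≤-<-connex (toℕ m) (toℕ n)
  ...   | inj₁ m≤n = inj₂ (inj₂ (beyond (ray σ (toℕ m)) (inside σ n i) (site m) (pole σ)
    (ray-inside-> σ n i m≤n) (ℤ.≤-reflexive (ray-site-≡ σ m)) (ℤ.≤-reflexive (ray-pole σ (toℕ m)))))
  ...   | inj₂ n<m = inj₂ (inj₂ (ray σ (toℕ m) , excludes
    (ray-inside-< σ n i n<m) (ℤ.≤-reflexive (sym (ray-site-≡ σ m))) (ℤ.≤-reflexive (sym (ray-pole σ (toℕ m))))))
  link-clear (chord σ n {i} {l} l∈) (pole τ) with τ Bool.≟ σ
  ... | yes refl = embed-clear σ n l∈ apex
  ... | no τ≢σ rewrite Bool.¬-not τ≢σ = inj₂ (inj₂ (height σ , excludes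
    (height-pole⁻ σ) (ℤ.<⇒≤ (height-inside σ n i)) (height-embed σ n l)))
  -- Sites outside the gap are cut off by its two rays; sites n and n + 1 are the bases of the unit
  -- and fall under the local table.
  link-clear (chord σ n {i} {l} l∈) (site k) with ℕ.<-cmp (toℕ k) (toℕ n) | ℕ.<-cmp (toℕ k) (ℕ.suc (toℕ n))
  ... | tri< k<n _ _ | _ = inj₂ (inj₂ (ray σ (toℕ n) , excludes
    (ray-site-< σ k<n) (ℤ.<⇒≤ (ray-inside-> σ n i ℕ.≤-refl)) (ray-embed-≥ σ n l ℕ.≤-refl)))
  ... | tri≈ _ k≡n _ | _
    rewrite Fin.toℕ-injective (trans k≡n (sym (Fin.toℕ-inject₁ n))) = embed-clear σ n l∈ (base false)
  ... | tri> _ _ n<k | tri< k<1+n _ _ = contradiction n<k (ℕ.≤⇒≯ (ℕ.s≤s⁻¹ k<1+n))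
  ... | tri> _ _ _   | tri≈ _ k≡1+n _
    rewrite Fin.toℕ-injective {j = suc n} k≡1+n = embed-clear σ n l∈ (base true)
  ... | tri> _ _ _   | tri> _ _ 1+n<k = inj₂ (inj₂ (beyond (ray σ (ℕ.suc (toℕ n)))
    (site k) (inside σ n i) (embed σ n l)
    (ray-site-> σ 1+n<k) (ℤ.<⇒≤ (ray-inside-< σ n i ℕ.≤-refl)) (ray-embed-≤ σ n l ℕ.≤-refl)))
  link-clear (chord σ n {i} {l} l∈) (inside τ k j) with τ Bool.≟ σ
  ... | no τ≢σ rewrite Bool.¬-not τ≢σ = inj₂ (inj₂ (height σ , excludes
    (height-inside⁻ σ k j) (ℤ.<⇒≤ (height-inside σ n i)) (height-embed σ n l)))
  ... | yes refl with Fin.<-cmp k n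
  ...   | tri< k<n _ _ = inj₂ (inj₂ (ray σ (toℕ n) , excludes
    (ray-inside-< σ k j k<n) (ℤ.<⇒≤ (ray-inside-> σ n i ℕ.≤-refl)) (ray-embed-≥ σ n l ℕ.≤-refl)))
  ...   | tri≈ _ refl _ = embed-clear σ n l∈ (inner j)
  ...   | tri> _ _ n<k = inj₂ (inj₂ (beyond (ray σ (toℕ k)) (inside σ k j) (inside σ n i) (embed σ n l)
    (ray-inside-> σ k j ℕ.≤-refl) (ℤ.<⇒≤ (ray-inside-< σ n i n<k)) (ray-embed-≤ σ n l n<k)))

  ~⇒link : ∀ {u v} → u ~ v → Link u v ⊎ Link v u
  ~⇒link {u} {v} = [ inj₂ ∘ link u v , inj₁ ∘ link v u ]′

  edge-clear : ∀ {u v} → u ~ v → ∀ w → w ≡ u ⊎ w ≡ v ⊎ Exc w u v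
  edge-clear {u} {v} u~v w with ~⇒link {u} {v} u~v
  ... | inj₁ l = link-clear l w
  ... | inj₂ l with link-clear l w
  ...   | inj₁ w≡v = inj₂ (inj₁ w≡v)
  ...   | inj₂ (inj₁ w≡u) = inj₁ w≡u
  ...   | inj₂ (inj₂ (F , excludes p q r)) = inj₂ (inj₂ (F , excludes p r q))

  flipˡ : ∀ u v x y → Sep u v x y → Sep v u x y
  flipˡ u v x y (F , separates p q r s t) = F , separates q p r s (map₁ swap t)

  flipʳ : ∀ u v x y → Sep u v x y → Sep u v y x
  flipʳ u v x y (F , separates p q r s t) = F , separates p q s r (map₂ swap t)

  edges-separated : ∀ {u v x y} → u ~ v → x ~ y → ¬ ((u ≡ x × v ≡ y) ⊎ (u ≡ y × v ≡ x)) → Sep u v x y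
  edges-separated {u} {v} {x} {y} u~v x~y distinct with ~⇒link {u} {v} u~v | ~⇒link {x} {y} x~y
  ... | inj₁ k | inj₁ l with links-separated k l
  ...   | inj₁ e = contradiction (inj₁ e) distinct
  ...   | inj₂ S = S
  edges-separated {u} {v} {x} {y} u~v x~y distinct | inj₁ k | inj₂ l with links-separated k l
  ...   | inj₁ e = contradiction (inj₂ e) distinct
  ...   | inj₂ S = flipʳ u v y x S
  edges-separated {u} {v} {x} {y} u~v x~y distinct | inj₂ k | inj₁ l with links-separated k l
  ...   | inj₁ (e , f) = contradiction (inj₂ (f , e)) distinct
  ...   | inj₂ S = flipˡ v u x y S
  edges-separated {u} {v} {x} {y} u~v x~y distinct | inj₂ k | inj₂ l with links-separated k l
  ...   | inj₁ (e , f) = contradiction (inj₁ (f , e)) distinct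
  ...   | inj₂ S = flipˡ v u x y (flipʳ v u y x S)

  position : Vertex → Point
  position v = point (place v)

  on-segment : ∀ {p a b} → p on (a ∷ b ∷ []) → p ∈[ a , b ]
  on-segment (here p∈)  = p∈
  on-segment (there ())

  no-vertex : ∀ {u v w} → u ~ v → position w on (position u ∷ position v ∷ []) → w ≡ u ⊎ w ≡ v
  no-vertex {u} {v} {w} u~v w-on with edge-clear {u} {v} u~v w
  ... | inj₁ w≡u        = inj₁ w≡u
  ... | inj₂ (inj₁ w≡v) = inj₂ w≡v
  ... | inj₂ (inj₂ exc) = contradiction (on-segment {position w} {position u} {position v} w-on)
                                        (excluded-∉ {place w} {place u} {place v} exc)

  -- Separated segments meet only in an end of one of them. An end of the second edge is a vertex on
  -- the first, hence by `no-vertex` an end of the first.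
  no-crossing : ∀ {u v x y} → u ~ v → x ~ y → ¬ ((u ≡ x × v ≡ y) ⊎ (u ≡ y × v ≡ x)) →
                ∀ p → p on (position u ∷ position v ∷ []) → p on (position x ∷ position y ∷ []) →
                p ≡ position u ⊎ p ≡ position v
  no-crossing {u} {v} {x} {y} u~v x~y distinct p p-uv p-xy =
    [ (λ end → end) , [ at-vertex x , at-vertex y ]′ ]′
      (separated-meet {place u} {place v} {place x} {place y} {p} (edges-separated {u} {v} {x} {y} u~v x~y distinct)
        (on-segment {p} {position u} {position v} p-uv) (on-segment {p} {position x} {position y} p-xy))
    where
    at-vertex : ∀ w → p ≡ position w → p ≡ position u ⊎ p ≡ position v
    at-vertex w p≡w = map (λ w≡u → trans p≡w (cong position w≡u)) (λ w≡v → trans p≡w (cong position w≡v))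
      (no-vertex {u} {v} {w} u~v (subst (_on (position u ∷ position v ∷ [])) p≡w p-uv))

  two-neighbours : ∀ u → ∃[ v ] ∃[ w ] v ≢ w × u ~ v × u ~ w
  two-neighbours (pole σ)              = site zero , site (suc zero) , (λ ()) ,
    inj₁ (link-parents (spoke zero σ)) , inj₁ (link-parents (spoke (suc zero) σ))
  two-neighbours (site m)              = pole false , pole true , (λ ()) ,
    inj₂ (here refl) , inj₂ (there (here refl))
  two-neighbours (inside σ n hub)      = pole σ , site (inject₁ n) , (λ ()) ,
    inj₂ (here refl) , inj₂ (there (here refl))
  two-neighbours (inside σ n (near d)) = pole σ , site (side n d) , (λ ()) ,
    inj₂ (here refl) , inj₂ (there (here refl))
  two-neighbours (inside σ n (far d))  = site (side n d) , inside σ n hub , (λ ()) ,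
    inj₂ (here refl) , inj₂ (there (here refl))

  -- If `v` sat at the position of `u`, it would lie on every edge at `u`. By `no-vertex` it is then
  -- `u` or the other end of each such edge, and two different neighbours cannot both be `v`.
  position-injective : ∀ {u v} → position u ≡ position v → u ≡ v
  position-injective {u} {v} eq = conclude (two-neighbours u)
    where
    end-of : ∀ x → u ~ x → v ≡ u ⊎ v ≡ x
    end-of x u~x = no-vertex {u} {x} {v} u~x
      (subst (_on (position u ∷ position x ∷ [])) eq (here (∈-segment-start (position u) (position x))))
    conclude : (∃[ x ] ∃[ y ] x ≢ y × u ~ x × u ~ y) → u ≡ v
    conclude (x , y , x≢y , u~x , u~y) =
      [ sym , (λ v≡x → [ sym , (λ v≡y → contradiction (trans (sym v≡x) v≡y) x≢y) ]′ (end-of y u~y)) ]′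
        (end-of x u~x)

  planar : IsPlanar G
  planar = record
    { position           = position
    ; bends              = λ _ _ → []
    ; position-injective = position-injective
    ; bends-sym          = λ _ → refl
    ; arc-simple         = λ {u} {v} u~v → segment (λ eq → Graph.~-irrefl G {u} {v} (position-injective eq) u~v)
    ; no-vertex          = λ {u} {v} {w} → no-vertex {u} {v} {w}
    ; no-crossing        = λ {u} {v} {x} {y} → no-crossing {u} {v} {x} {y}
    }

theorem6 : Σ[ G ∈ Graph ]
    (IsConnected 3 G × ¬ IsComplete G × IsPlanar G × ¬ IsDegreeTruncatedChoosable 7 G)
-- The 49 columns of three sites need 147 = 3 + 144 sites; `refl` checks this count.
theorem6 = Strip.G 144 , Strip.3-connected 144 , Strip.¬complete 144 , Drawing.planar 144 ,
  ¬choosable (columns refl)
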